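{- Let $\mathcal{P}$ be an $n\times n$ symmetric sign pattern with all diagonal entries equal to $0$ whose underlying graph $G(\mathcal{P})$ is a cycle of length $n$ ($n\ge 3$). Then $\mathcal{P}$ requires full $P$-vertices if and only if $n$ is even and all composite cycles of length $n$ in the signed directed graph $D(\mathcal{P})$ have the same sign.
   Context: A sign pattern of order $n$ is an $n\times n$ matrix $\mathcal{P}=[p_{ij}]$ with entries in $\{+,-,0\}$; it is symmetric if $p_{ij}=p_{ji}$ for all $i,j$. $\mathcal{Q}_{\mathrm{SYM}}(\mathcal{P})$ is the set of all real symmetric $n\times n$ matrices $A=[a_{ij}]$ with $\mathrm{sgn}(a_{ij})=p_{ij}$ for all $i,j$. The underlying graph $G(\mathcal{P})$ is the undirected graph on vertices $v_1,\dots,v_n$ with an edge $\{v_i,v_j\}$ exactly when $p_{ij}\neq 0$. The signed directed graph $D(\mathcal{P})$ has vertices $v_1,\dots,v_n$ and a directed edge $(v_i,v_j)$, labelled by the sign $p_{ij}$, exactly when $p_{ij}\ne0$. A simple cycle of length $k\ge 1$ in $D(\mathcal{P})$ is a product $\gamma=p_{i_1i_2}p_{i_2i_3}\cdots p_{i_ki_1}$ of nonzero entries with $i_1,\dots,i_k$ distinct (so an edge $\{v_i,v_j\}$ of $G(\mathcal{P})$ gives a simple cycle $p_{ij}p_{ji}$ of length 2); its sign is $\mathrm{sgn}(\gamma)=(-1)^{k-1}p_{i_1i_2}p_{i_2i_3}\cdots p_{i_ki_1}$. A composite cycle is a product $\Gamma=\gamma_1\cdots\gamma_t$ ($t\ge1$)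 of mutually vertex-disjoint simple cycles; its length is the sum of the lengths of the $\gamma_i$ and its sign is $\prod_{i=1}^t\mathrm{sgn}(\gamma_i)$. For a real symmetric matrix $A$, $m_A(0)$ is the algebraic multiplicity of $0$ as an eigenvalue of $A$ (zero if $0$ is not an eigenvalue), and $A(j)$ is the principal submatrix obtained by deleting row and column $j$. The vertex $v_j$ is a $P$-vertex of $A$ if $m_{A(j)}(0)-m_A(0)=1$. The pattern $\mathcal{P}$ of order $n$ requires full $P$-vertices if, for every $A\in\mathcal{Q}_{\mathrm{SYM}}(\mathcal{P})$, all $n$ vertices are $P$-vertices of $A$. -}

module Defs where

open import Algebra.Bundles using (AbelianGroup; RawRing)
import Algebra.Definitions.RawMonoid as RawMonoidOps
import Algebra.Definitions.RawSemiring as RawSemiringOps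
import Algebra.Properties.AbelianGroup as AbelianGroupProperties
import Algebra.Properties.CommutativeSemigroup as CommutativeSemigroupProperties
import Algebra.Properties.Ring as RingProperties
open import Data.Bool.Base using (if_then_else_)
open import Data.Fin.Base using (Fin; zero; suc; toℕ)
open import Data.Fin.Permutation using (Permutation′; _⟨$⟩ʳ_)
import Data.Fin.Properties as Fin
open import Data.Integer.Base as ℤ using (ℤ)
open import Data.List.Base as List using (List; []; _∷_)
open import Data.List.NonEmpty.Base as List⁺ using (List⁺)
open import Data.List.Relation.Unary.AllPairs using (AllPairs)
open import Data.Maybe.Base using (Maybe; just; nothing)
open import Data.Nat.Base as ℕ using (ℕ; zero; suc; pred)
open import Data.Nat.DivMod using (_mod_)
import Data.Nat.Properties as ℕ
open import Data.Nat.ListAction using (sum)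
open import Data.Product.Base using (_×_; _,_; ∃; ∃-syntax)
open import Data.Rational.Base as ℚ using (ℚ; 0ℚ; 1ℚ; ½)
import Data.Rational.Properties as ℚ
open import Data.Sign.Base as Sign using (Sign)
open import Data.Sum.Base using (_⊎_)
open import Data.Vec.Functional using (Vector; removeAt)
open import Function.Bundles using (_⇔_)
open import Function.Definitions using (Injective)
open import Level using (0ℓ)
open import Relation.Binary.Core using (Rel)
open import Relation.Binary.PropositionalEquality
open import Relation.Nullary.Decidable.Core using (does)

------------------------------------------------------------------------
-- Real numbers: Cauchy sequences of rationals, with setoid equality _≃_.
-- All operations act pointwise.

Eventually : (ℕ → Set) → Set
Eventually Q = ∃[ N ] ∀ n → N ℕ.≤ n → Q n

IsCauchy : (ℕ → ℚ) → Set
IsCauchy s = ∀ ε → 0ℚ ℚ.< ε →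
  ∃[ N ] ∀ m n → N ℕ.≤ m → N ℕ.≤ n → ℚ.∣ s m ℚ.- s n ∣ ℚ.< ε

record ℝ : Set where
  constructor mkℝ
  field
    seq    : ℕ → ℚ
    cauchy : IsCauchy seq

open ℝ public

private
  halves : ∀ ε → ½ ℚ.* ε ℚ.+ ½ ℚ.* ε ≡ ε
  halves ε = trans (sym (ℚ.*-distribʳ-+ ε ½ ½)) (ℚ.*-identityˡ ε)

  half-pos : ∀ {ε} → 0ℚ ℚ.< ε → 0ℚ ℚ.< ½ ℚ.* ε
  half-pos = ℚ.*-monoʳ-<-pos ½

  open AbelianGroupProperties ℚ.+-0-abelianGroup using (//-rightDividesˡ)
  open CommutativeSemigroupProperties
    (AbelianGroup.commutativeSemigroup ℚ.+-0-abelianGroup) using (interchange)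
  open RingProperties ℚ.+-*-ring using (x[y-z]≈xy-xz; [y-z]x≈yx-zx)

  neg-distance : ∀ p q → ℚ.∣ p ℚ.- q ∣ ≡ ℚ.∣ (ℚ.- p) ℚ.- (ℚ.- q) ∣
  neg-distance p q = trans (sym (ℚ.∣-p∣≡∣p∣ (p ℚ.- q)))
                           (cong ℚ.∣_∣ (ℚ.neg-distrib-+ p (ℚ.- q)))

  +-difference : ∀ a b c d →
    (a ℚ.+ b) ℚ.- (c ℚ.+ d) ≡ (a ℚ.- c) ℚ.+ (b ℚ.- d)
  +-difference a b c d = trans (cong ((a ℚ.+ b) ℚ.+_) (ℚ.neg-distrib-+ c d))
                               (interchange a b (ℚ.- c) (ℚ.- d))

  *-difference : ∀ a b c d →
    a ℚ.* b ℚ.- c ℚ.* d ≡ (a ℚ.- c) ℚ.* b ℚ.+ c ℚ.* (b ℚ.- d)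
  *-difference a b c d = sym (begin
    (a ℚ.- c) ℚ.* b ℚ.+ c ℚ.* (b ℚ.- d)
      ≡⟨ cong₂ ℚ._+_ ([y-z]x≈yx-zx b a c) (x[y-z]≈xy-xz c b d) ⟩
    (a ℚ.* b ℚ.- c ℚ.* b) ℚ.+ (c ℚ.* b ℚ.- c ℚ.* d)
      ≡⟨ ℚ.+-assoc (a ℚ.* b ℚ.- c ℚ.* b) (c ℚ.* b) (ℚ.- (c ℚ.* d)) ⟨
    ((a ℚ.* b ℚ.- c ℚ.* b) ℚ.+ c ℚ.* b) ℚ.- c ℚ.* d
      ≡⟨ cong (ℚ._- c ℚ.* d) (//-rightDividesˡ (c ℚ.* b) (a ℚ.* b)) ⟩
    a ℚ.* b ℚ.- c ℚ.* d ∎)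
    where open ≡-Reasoning

  *-mono-<-nonNeg : ∀ {p q r s} → 0ℚ ℚ.≤ p → 0ℚ ℚ.< s →
                    p ℚ.< q → r ℚ.< s → p ℚ.* r ℚ.< q ℚ.* s
  *-mono-<-nonNeg {p} {q} {r} {s} 0≤p 0<s p<q r<s = ℚ.≤-<-trans
    (ℚ.*-monoˡ-≤-nonNeg p ⦃ ℚ.nonNegative 0≤p ⦄ (ℚ.<⇒≤ r<s))
    (ℚ.*-monoˡ-<-pos s ⦃ ℚ.positive 0<s ⦄ p<q)

  bounded : ∀ s → IsCauchy s →
            ∃[ K ] 0ℚ ℚ.< K × Eventually (λ n → ℚ.∣ s n ∣ ℚ.< K)
  bounded s c with c 1ℚ (ℚ.positive⁻¹ 1ℚ)
  ... | N , close = 1ℚ ℚ.+ ℚ.∣ s N ∣ , K>0 , N , bound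
    where
    K>0 : 0ℚ ℚ.< 1ℚ ℚ.+ ℚ.∣ s N ∣
    K>0 = ℚ.+-mono-<-≤ (ℚ.positive⁻¹ 1ℚ) (ℚ.0≤∣p∣ (s N))

    bound : ∀ n → N ℕ.≤ n → ℚ.∣ s n ∣ ℚ.< 1ℚ ℚ.+ ℚ.∣ s N ∣
    bound n N≤n = ℚ.≤-<-trans
      (ℚ.≤-trans (ℚ.≤-reflexive (cong ℚ.∣_∣ (sym (//-rightDividesˡ (s N) (s n)))))
                 (ℚ.∣p+q∣≤∣p∣+∣q∣ (s n ℚ.- s N) (s N)))
      (ℚ.+-monoˡ-< ℚ.∣ s N ∣ (close n N N≤n ℕ.≤-refl))

abstract
  const-cauchy : ∀ q → IsCauchy (λ _ → q)
  const-cauchy q ε 0<ε = 0 , λ _ _ _ _ →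
    subst (ℚ._< ε) (sym (cong ℚ.∣_∣ (ℚ.+-inverseʳ q))) 0<ε

  neg-cauchy : ∀ s → IsCauchy s → IsCauchy (λ n → ℚ.- s n)
  neg-cauchy s c ε 0<ε with c ε 0<ε
  ... | N , close = N , λ m n N≤m N≤n →
    subst (ℚ._< ε) (neg-distance (s m) (s n)) (close m n N≤m N≤n)

  +-cauchy : ∀ s t → IsCauchy s → IsCauchy t → IsCauchy (λ n → s n ℚ.+ t n)
  +-cauchy s t c d ε 0<ε
    with c (½ ℚ.* ε) (half-pos 0<ε) | d (½ ℚ.* ε) (half-pos 0<ε)
  ... | M , close-s | N , close-t = M ℕ.⊔ N , λ m n ≤m ≤n →
    ℚ.≤-<-trans
      (ℚ.≤-trans (ℚ.≤-reflexive (cong ℚ.∣_∣ (+-difference (s m) (t m) (s n) (t n))))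
                 (ℚ.∣p+q∣≤∣p∣+∣q∣ (s m ℚ.- s n) (t m ℚ.- t n)))
      (subst (_ ℚ.<_) (halves ε)
        (ℚ.+-mono-< (close-s m n (ℕ.m⊔n≤o⇒m≤o M N ≤m) (ℕ.m⊔n≤o⇒m≤o M N ≤n))
                    (close-t m n (ℕ.m⊔n≤o⇒n≤o M N ≤m) (ℕ.m⊔n≤o⇒n≤o M N ≤n))))

  *-cauchy : ∀ s t → IsCauchy s → IsCauchy t → IsCauchy (λ n → s n ℚ.* t n)
  *-cauchy s t c d ε 0<ε with bounded s c | bounded t d
  ... | K , 0<K , M₁ , bound-s | L , 0<L , M₂ , bound-t
    with c (scaled L 0<L) (scaled-pos L 0<L) | d (scaled K 0<K) (scaled-pos K 0<K)
    where
    scaled : ∀ B → 0ℚ ℚ.< B → ℚ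
    scaled B 0<B = (½ ℚ.* ε) ℚ.* (ℚ.1/ B) ⦃ ℚ.>-nonZero 0<B ⦄

    scaled-pos : ∀ B 0<B → 0ℚ ℚ.< scaled B 0<B
    scaled-pos B 0<B = ℚ.positive⁻¹ _
      ⦃ ℚ.pos*pos⇒pos (½ ℚ.* ε) ⦃ ℚ.positive (half-pos 0<ε) ⦄
                      _ ⦃ ℚ.1/pos⇒pos B ⦃ ℚ.positive 0<B ⦄ ⦄ ⦄
  ... | N₁ , close-s | N₂ , close-t = (M₁ ℕ.⊔ M₂) ℕ.⊔ (N₁ ℕ.⊔ N₂) , λ m n ≤m ≤n →
    ℚ.≤-<-trans
      (ℚ.≤-trans (ℚ.≤-reflexive (cong ℚ.∣_∣ (*-difference (s m) (t m) (s n) (t n))))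
        (ℚ.≤-trans (ℚ.∣p+q∣≤∣p∣+∣q∣ ((s m ℚ.- s n) ℚ.* t m) (s n ℚ.* (t m ℚ.- t n)))
          (ℚ.≤-reflexive (cong₂ ℚ._+_ (ℚ.∣p*q∣≡∣p∣*∣q∣ (s m ℚ.- s n) (t m))
                                      (ℚ.∣p*q∣≡∣p∣*∣q∣ (s n) (t m ℚ.- t n))))))
      (subst (_ ℚ.<_)
        (trans (cong₂ ℚ._+_ (cancel L 0<L) (cancel K 0<K)) (halves ε))
        (ℚ.+-mono-<
          (*-mono-<-nonNeg (ℚ.0≤∣p∣ (s m ℚ.- s n)) 0<L
            (close-s m n (≤N₁ ≤m) (≤N₁ ≤n)) (bound-t m (≤M₂ ≤m)))
          (subst (ℚ._< _) (ℚ.*-comm ℚ.∣ t m ℚ.- t n ∣ ℚ.∣ s n ∣)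
            (*-mono-<-nonNeg (ℚ.0≤∣p∣ (t m ℚ.- t n)) 0<K
              (close-t m n (≤N₂ ≤m) (≤N₂ ≤n)) (bound-s n (≤M₁ ≤n))))))
    where
    cancel : ∀ B (0<B : 0ℚ ℚ.< B) →
      (½ ℚ.* ε) ℚ.* (ℚ.1/ B) ⦃ ℚ.>-nonZero 0<B ⦄ ℚ.* B ≡ ½ ℚ.* ε
    cancel B 0<B = trans (ℚ.*-assoc (½ ℚ.* ε) _ B)
      (trans (cong ((½ ℚ.* ε) ℚ.*_) (ℚ.*-inverseˡ B ⦃ ℚ.>-nonZero 0<B ⦄))
             (ℚ.*-identityʳ (½ ℚ.* ε)))

    ≤M₁ : ∀ {o} → (M₁ ℕ.⊔ M₂) ℕ.⊔ (N₁ ℕ.⊔ N₂) ℕ.≤ o → M₁ ℕ.≤ o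
    ≤M₁ ≤o = ℕ.m⊔n≤o⇒m≤o M₁ M₂ (ℕ.m⊔n≤o⇒m≤o (M₁ ℕ.⊔ M₂) (N₁ ℕ.⊔ N₂) ≤o)
    ≤M₂ : ∀ {o} → (M₁ ℕ.⊔ M₂) ℕ.⊔ (N₁ ℕ.⊔ N₂) ℕ.≤ o → M₂ ℕ.≤ o
    ≤M₂ ≤o = ℕ.m⊔n≤o⇒n≤o M₁ M₂ (ℕ.m⊔n≤o⇒m≤o (M₁ ℕ.⊔ M₂) (N₁ ℕ.⊔ N₂) ≤o)
    ≤N₁ : ∀ {o} → (M₁ ℕ.⊔ M₂) ℕ.⊔ (N₁ ℕ.⊔ N₂) ℕ.≤ o → N₁ ℕ.≤ o
    ≤N₁ ≤o = ℕ.m⊔n≤o⇒m≤o N₁ N₂ (ℕ.m⊔n≤o⇒n≤o (M₁ ℕ.⊔ M₂) (N₁ ℕ.⊔ N₂) ≤o)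
    ≤N₂ : ∀ {o} → (M₁ ℕ.⊔ M₂) ℕ.⊔ (N₁ ℕ.⊔ N₂) ℕ.≤ o → N₂ ℕ.≤ o
    ≤N₂ ≤o = ℕ.m⊔n≤o⇒n≤o N₁ N₂ (ℕ.m⊔n≤o⇒n≤o (M₁ ℕ.⊔ M₂) (N₁ ℕ.⊔ N₂) ≤o)

infix 4 _≃_ _<_ _#_

_≃_ : Rel ℝ 0ℓ
x ≃ y = ∀ ε → 0ℚ ℚ.< ε → Eventually λ n → ℚ.∣ seq x n ℚ.- seq y n ∣ ℚ.< ε

-- The gap ε must be uniform: a pointwise strict inequality of the
-- sequences would not exclude equal limits.
_<_ : Rel ℝ 0ℓ
x < y = ∃[ ε ] 0ℚ ℚ.< ε × Eventually λ n → seq x n ℚ.+ ε ℚ.≤ seq y n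

-- Apartness, the constructive form of x ≠ y.
_#_ : Rel ℝ 0ℓ
x # y = x < y ⊎ y < x

fromℚ : ℚ → ℝ
fromℚ q = mkℝ (λ _ → q) (const-cauchy q)

0ℝ : ℝ
0ℝ = fromℚ 0ℚ

ℝ-rawRing : RawRing 0ℓ 0ℓ
ℝ-rawRing = record
  { Carrier = ℝ
  ; _≈_     = _≃_
  ; _+_     = λ x y → mkℝ (λ n → seq x n ℚ.+ seq y n) (+-cauchy (seq x) (seq y) (cauchy x) (cauchy y))
  ; _*_     = λ x y → mkℝ (λ n → seq x n ℚ.* seq y n) (*-cauchy (seq x) (seq y) (cauchy x) (cauchy y))
  ; -_      = λ x → mkℝ (λ n → ℚ.- seq x n) (neg-cauchy (seq x) (cauchy x))
  ; 0#      = 0ℝ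
  ; 1#      = fromℚ 1ℚ
  }

------------------------------------------------------------------------
-- Matrices and determinants

Matrix : Set → ℕ → Set
Matrix A n = Vector (Vector A n) n

-- The principal submatrix A(j).
principal : ∀ {A : Set} {n} → Matrix A n → Fin n → Matrix A (pred n)
principal {n = suc _} M j r = removeAt (removeAt M j r) j

module _ (R : RawRing 0ℓ 0ℓ) where
  open RawRing R
  open RawSemiringOps rawSemiring using (_^_) renaming (sum to ∑)

  -- Laplace expansion along the first row.
  det : ∀ {n} → Matrix Carrier n → Carrier
  det {zero}  M = 1#
  det {suc n} M = ∑ λ j →
    ((- 1#) ^ toℕ j * M zero j) * det (λ r → removeAt (M (suc r)) j)

------------------------------------------------------------------------
-- Polynomials as coefficient lists, constant term first. Equality
-- compares coefficients, so trailing zeros are immaterial.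

module Polynomial (R : RawRing 0ℓ 0ℓ) where
  open RawRing R

  Poly : Set
  Poly = List Carrier

  coeff : Poly → ℕ → Carrier
  coeff []      _       = 0#
  coeff (a ∷ _) zero    = a
  coeff (_ ∷ p) (suc k) = coeff p k

  const : Carrier → Poly
  const a = a ∷ []

  X : Poly
  X = 0# ∷ 1# ∷ []

  add : Poly → Poly → Poly
  add []      q       = q
  add (a ∷ p) []      = a ∷ p
  add (a ∷ p) (b ∷ q) = a + b ∷ add p q

  mul : Poly → Poly → Poly
  mul []      q = []
  mul (a ∷ p) q = add (List.map (a *_) q) (0# ∷ mul p q)

  eval : Poly → Carrier → Carrier
  eval p x = List.foldr (λ a v → a + x * v) 0# p

  rawRing : RawRing 0ℓ 0ℓ
  rawRing = record
    { Carrier = Poly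
    ; _≈_     = λ p q → ∀ k → coeff p k ≈ coeff q k
    ; _+_     = add
    ; _*_     = mul
    ; -_      = List.map -_
    ; 0#      = []
    ; 1#      = const 1#
    }

open Polynomial ℝ-rawRing public using (Poly; const; X; eval)

ℝ[X] : RawRing 0ℓ 0ℓ
ℝ[X] = Polynomial.rawRing ℝ-rawRing

module _ where
  open RawRing ℝ[X]
  open RawSemiringOps rawSemiring using (_^_)

  -- det (X I − A)
  charPoly : ∀ {n} → Matrix ℝ n → Poly
  charPoly A = det ℝ[X] λ i j →
    (if does (i Fin.≟ j) then X else 0#) + (- const (A i j))

  -- p = (X − x)^m q with q(x) ≠ 0; m = 0 when x is not a root of p.
  IsRootMultiplicity : Poly → ℝ → ℕ → Set
  IsRootMultiplicity p x m =
    ∃[ q ] p ≈ (X + (- const x)) ^ m * q × eval q x # 0ℝ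

-- A relation rather than a function: equality of reals is not decidable,
-- so the multiplicity cannot be computed from the matrix.
IsAlgebraicMultiplicity : ∀ {n} → Matrix ℝ n → ℝ → ℕ → Set
IsAlgebraicMultiplicity A = IsRootMultiplicity (charPoly A)

IsPVertex : ∀ {n} → Matrix ℝ n → Fin n → Set
IsPVertex A j = ∃[ m ] ∃[ m′ ]
    IsAlgebraicMultiplicity A 0ℝ m
  × IsAlgebraicMultiplicity (principal A j) 0ℝ m′
  × ℤ.+ m′ ℤ.- ℤ.+ m ≡ ℤ.+ 1

------------------------------------------------------------------------
-- Sign patterns

-- nothing stands for the entry 0.
SignPattern : ℕ → Set
SignPattern n = Matrix (Maybe Sign) n

Symmetric : ∀ {n} → SignPattern n → Set
Symmetric P = ∀ i j → P i j ≡ P j i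

HasSign : ℝ → Maybe Sign → Set
HasSign x (just Sign.+) = 0ℝ < x
HasSign x (just Sign.-) = x < 0ℝ
HasSign x nothing       = x ≃ 0ℝ

record _∈Q-SYM_ {n} (A : Matrix ℝ n) (P : SignPattern n) : Set where
  field
    symmetric : ∀ i j → A i j ≃ A j i
    signs     : ∀ i j → HasSign (A i j) (P i j)

RequiresFullPVertices : ∀ {n} → SignPattern n → Set
RequiresFullPVertices P = ∀ A → A ∈Q-SYM P → ∀ j → IsPVertex A j

-- The adjacency relation of G(P).
UnderlyingGraph : ∀ {n} → SignPattern n → Rel (Fin n) 0ℓ
UnderlyingGraph P i j = P i j ≢ nothing

-- i ↦ i + 1 modulo n.
next : ∀ {n} → Fin n → Fin n
next {suc n} i = suc (toℕ i) mod suc n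

-- The graph on Fin n is isomorphic to the cycle 0 – 1 – ⋯ – (n−1) – 0.
IsCycleGraph : ∀ {n} → Rel (Fin n) 0ℓ → Set
IsCycleGraph {n} _~_ = ∃ λ (σ : Permutation′ n) → ∀ i j →
  ((σ ⟨$⟩ʳ i) ~ (σ ⟨$⟩ʳ j)) ⇔ (j ≡ next i ⊎ i ≡ next j)

------------------------------------------------------------------------
-- Cycles of the signed digraph D(P)

open RawMonoidOps Sign.*-1-rawMonoid using () renaming (sum to ∏; _×_ to infixl 8 _times_)

-- The cycle i₀ → i₁ → ⋯ → i_{k−1} → i₀, where i_r = vertex r, k is suc
-- length-1, and label r is the (nonzero) sign of the edge leaving i_r.
record SimpleCycle {n} (P : SignPattern n) : Set where
  field
    length-1 : ℕ

  length : ℕ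
  length = suc length-1

  field
    vertex   : Vector (Fin n) length
    distinct : Injective _≡_ _≡_ vertex
    label    : Vector Sign length
    edge     : ∀ r → P (vertex r) (vertex (next r)) ≡ just (label r)

  -- (−1)^(k−1) times the product of the edge labels.
  sgn : Sign
  sgn = (length-1 times Sign.-) Sign.* ∏ label

VertexDisjoint : ∀ {n} {P : SignPattern n} → Rel (SimpleCycle P) 0ℓ
VertexDisjoint γ δ = ∀ r s → SimpleCycle.vertex γ r ≢ SimpleCycle.vertex δ s

record CompositeCycle {n} (P : SignPattern n) : Set where
  field
    factors  : List⁺ (SimpleCycle P)
    disjoint : AllPairs VertexDisjoint (List⁺.toList factors)

  length : ℕ
  length = sum (List.map SimpleCycle.length (List⁺.toList factors))

  sgn : Sign
  sgn = List.foldr Sign._*_ Sign.+ (List.map SimpleCycle.sgn (List⁺.toList factors))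

SameSignCompositeCycles : ∀ {n} → SignPattern n → ℕ → Set
SameSignCompositeCycles P k = (Γ Δ : CompositeCycle P) →
  CompositeCycle.length Γ ≡ k → CompositeCycle.length Δ ≡ k →
  CompositeCycle.sgn Γ ≡ CompositeCycle.sgn Δ

{-# OPTIONS --safe #-}

-- Number the vertices along the cycle, starting at the vertex to be removed.
-- Only the first two coefficients of a characteristic polynomial matter for
-- the multiplicity of 0, so det (X I − A) is computed modulo X². Write n = 2q.
-- For a path the determinant satisfies the three-term recursion of
-- continuants: an even path on 2k vertices has a constant coefficient of sign
-- (−1)^k, an odd one has constant coefficient 0 and a linear coefficient of
-- sign (−1)^k. This settles A(j); in particular A(j) is nonsingular for odd n,
-- and then v_j is not a P-vertex. For the whole cycle of even length the
-- constant coefficient is (−1)^q (e² + f²) − 2 e f, where e and f are the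
-- products of the weights over the two perfect matchings. It has sign (−1)^q
-- if − sgn (e f) = (−1)^q, and otherwise vanishes for the matrix with all
-- weights ±1. On the other side, a composite cycle of length n consists either
-- of 2-cycles, and has sign (−1)^q, or of the whole cycle, and has sign
-- − sgn (e f).
module Submission where


-- Equality of reals is undecidable, so a multiplicity is never computed. For sufficiency the
-- factorisations X⁰ p and X¹ q are exhibited with a cofactor whose value at 0 is apart from 0. For
-- necessity a given factorisation is only used to force low coefficients to vanish. This yields two
-- contradictions: m′ = m + 1 is at least 1, which a nonsingular A(j) forbids for odd n; and if A is
-- singular then m is at least 1 and m′ at least 2, which the nonzero linear coefficient for A(j)
-- forbids for even n.
--
-- Truncation modulo X² is a homomorphism to the dual numbers over ℝ, and all determinants are
-- computed there. Laplace expansion over `Fin` does not go well with renumbering, so determinants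
-- are restated for lists of row and column labels. Passing to the numbering along the cycle is then
-- a simultaneous permutation of both lists, which costs no sign.

-- Ring solver with integer coefficients.

module IntegerSolver where

  open import Algebra.Bundles using (CommutativeRing)
  import Algebra.Properties.AbelianGroup as AbelianGroupProperties
  import Algebra.Properties.Ring as RingProperties
  import Algebra.Properties.Semiring.Mult as SemiringMult
  import Algebra.Solver.Ring as RingSolver
  import Algebra.Solver.Ring.AlmostCommutativeRing as ACR
  open import Data.Integer.Base as ℤ using (ℤ; +_; -[1+_])
  import Data.Integer.Properties as ℤ
  open import Data.Maybe.Base using (nothing; just)
  open import Data.Nat.Base as ℕ using (ℕ; zero; suc)
  import Data.Nat.Properties as ℕ
  open import Level using (0ℓ)
  open import Relation.Binary.PropositionalEquality as ≡ using (_≡_)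
  import Relation.Binary.Reasoning.Setoid as SetoidReasoning
  open import Relation.Nullary.Decidable.Core using (yes; no)
  open import Relation.Binary.Definitions using (WeaklyDecidable)

  open ACR using (_-Raw-AlmostCommutative⟶_)

  -- The ring solver with integer coefficients: taking the coefficients in S
  -- itself would leave it unable to see that 1 + - 1 vanishes.
  module IntegerCoefficients (S : CommutativeRing 0ℓ 0ℓ) where

    open CommutativeRing S hiding (zero)
    open RingProperties ring using (-0#≈0#; -‿distribˡ-*; -‿distribʳ-*; -‿involutive)
    open AbelianGroupProperties +-abelianGroup using (⁻¹-∙-comm)
    open SemiringMult semiring using (×-homo-+; ×1-homo-*) renaming (_×_ to _·_)
    open SetoidReasoning setoid

    fromℤ : ℤ → Carrier
    fromℤ (+ n)    = n · 1#
    fromℤ -[1+ n ] = - (suc n · 1#)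

    private
      cancel : ∀ x y → 1# + x - (1# + y) ≈ x - y
      cancel x y = begin
        1# + x - (1# + y)      ≈⟨ +-cong (+-comm 1# x) (sym (⁻¹-∙-comm 1# y)) ⟩
        x + 1# + (- 1# - y)    ≈⟨ +-assoc x 1# _ ⟩
        x + (1# + (- 1# - y))  ≈⟨ +-congˡ (trans (sym (+-assoc 1# _ _)) (trans (+-congʳ (-‿inverseʳ 1#)) (+-identityˡ _))) ⟩
        x - y                  ∎

      fromℤ-⊖ : ∀ m n → fromℤ (m ℤ.⊖ n) ≈ m · 1# - n · 1#
      fromℤ-⊖ m       zero    = sym (trans (+-congˡ -0#≈0#) (+-identityʳ _))
      fromℤ-⊖ zero    (suc n) = sym (+-identityˡ _)
      fromℤ-⊖ (suc m) (suc n) = begin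
        fromℤ (suc m ℤ.⊖ suc n)        ≡⟨ ≡.cong fromℤ (ℤ.[1+m]⊖[1+n]≡m⊖n m n) ⟩
        fromℤ (m ℤ.⊖ n)                ≈⟨ fromℤ-⊖ m n ⟩
        m · 1# - n · 1#                ≈⟨ cancel _ _ ⟨
        1# + m · 1# - (1# + n · 1#)    ∎

      +-homo : ∀ i j → fromℤ (i ℤ.+ j) ≈ fromℤ i + fromℤ j
      +-homo (+ m)    (+ n)    = ×-homo-+ 1# m n
      +-homo (+ m)    -[1+ n ] = fromℤ-⊖ m (suc n)
      +-homo -[1+ m ] (+ n)    = trans (fromℤ-⊖ n (suc m)) (+-comm _ _)
      +-homo -[1+ m ] -[1+ n ] = begin
        - (suc (suc (m ℕ.+ n)) · 1#)     ≡⟨ ≡.cong (λ k → - (k · 1#)) (≡.sym (ℕ.+-suc (suc m) n)) ⟩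
        - ((suc m ℕ.+ suc n) · 1#)       ≈⟨ -‿cong (×-homo-+ 1# (suc m) (suc n)) ⟩
        - (suc m · 1# + suc n · 1#)      ≈⟨ ⁻¹-∙-comm _ _ ⟨
        - (suc m · 1#) - (suc n · 1#)    ∎

      -‿homo : ∀ i → fromℤ (ℤ.- i) ≈ - fromℤ i
      -‿homo (+ zero)  = sym -0#≈0#
      -‿homo (+ suc n) = refl
      -‿homo -[1+ n ]  = sym (-‿involutive _)

      *-homo-pos : ∀ m j → fromℤ (+ m ℤ.* j) ≈ fromℤ (+ m) * fromℤ j
      *-homo-pos m (+ n)    = trans (reflexive (≡.cong fromℤ (≡.sym (ℤ.pos-* m n)))) (×1-homo-* m n)
      *-homo-pos m -[1+ n ] = begin
        fromℤ (+ m ℤ.* (ℤ.- (+ suc n)))    ≡⟨ ≡.cong fromℤ (≡.sym (ℤ.neg-distribʳ-* (+ m) (+ suc n))) ⟩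
        fromℤ (ℤ.- (+ m ℤ.* + suc n))      ≈⟨ -‿homo (+ m ℤ.* + suc n) ⟩
        - fromℤ (+ m ℤ.* + suc n)          ≈⟨ -‿cong (*-homo-pos m (+ suc n)) ⟩
        - (m · 1# * suc n · 1#)            ≈⟨ -‿distribʳ-* _ _ ⟩
        m · 1# * - (suc n · 1#)            ∎

      *-homo : ∀ i j → fromℤ (i ℤ.* j) ≈ fromℤ i * fromℤ j
      *-homo (+ m)    j = *-homo-pos m j
      *-homo -[1+ m ] j = begin
        fromℤ (ℤ.- (+ suc m) ℤ.* j)        ≡⟨ ≡.cong fromℤ (≡.sym (ℤ.neg-distribˡ-* (+ suc m) j)) ⟩
        fromℤ (ℤ.- (+ suc m ℤ.* j))        ≈⟨ -‿homo (+ suc m ℤ.* j) ⟩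
        - fromℤ (+ suc m ℤ.* j)            ≈⟨ -‿cong (*-homo-pos (suc m) j) ⟩
        - (suc m · 1# * fromℤ j)           ≈⟨ -‿distribˡ-* _ _ ⟩
        - (suc m · 1#) * fromℤ j           ∎

    private
      almostRing = ACR.fromCommutativeRing S

      morphism : ℤ.+-*-rawRing -Raw-AlmostCommutative⟶ almostRing
      morphism = record
        { ⟦_⟧ = fromℤ ; +-homo = +-homo ; *-homo = *-homo ; -‿homo = -‿homo
        ; 0-homo = refl ; 1-homo = +-identityʳ 1# }

      coefficient≟ : WeaklyDecidable (ACR.Induced-equivalence morphism)
      coefficient≟ i j with i ℤ.≟ j
      ... | yes i≡j = just (reflexive (≡.cong fromℤ i≡j))
      ... | no  _   = nothing

    open RingSolver ℤ.+-*-rawRing almostRing morphism coefficient≟ public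
      using (solve; _:=_; _:+_; _:*_; _:-_; :-_; con)

-- Determinants over lists of row and column labels.

module Determinants where

  open import Algebra.Bundles using (CommutativeRing; RawRing)
  import Algebra.Definitions.RawSemiring as RawSemiringOps
  import Algebra.Properties.Ring as RingProperties
  import Algebra.Properties.Semiring.Exp as SemiringExp
  open import Data.Fin.Base using (Fin; zero; suc; toℕ; punchIn)
  open import Data.List.Base as List using (List; []; _∷_; tabulate; length)
  open import Data.List.Relation.Binary.Permutation.Propositional as Perm using (_↭_)
  open import Data.Nat.Base using (ℕ; zero; suc; _≤_; s≤s)
  import Data.Nat.Properties as ℕ
  open import Data.Product.Base using (_×_; _,_; ∃-syntax)
  open import Data.Vec.Functional using (removeAt)
  open import Function.Base using (_∘_)
  open import Level using (0ℓ)
  open import Relation.Binary.PropositionalEquality as ≡ using (_≡_)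
  import Relation.Binary.Reasoning.Setoid as SetoidReasoning
  open IntegerSolver
  open import Defs using (Matrix; det)

  module Determinant (S : CommutativeRing 0ℓ 0ℓ) where

    open CommutativeRing S hiding (zero)
    open RingProperties ring using (-0#≈0#; -‿distribˡ-*)
    open SetoidReasoning setoid

    open IntegerCoefficients S

    private
      variable
        I J : Set

    -- f c₀ (cs without c₀) − f c₁ (cs without c₁) + ⋯
    alt : (I → List I → Carrier) → List I → Carrier
    alt f []       = 0#
    alt f (c ∷ cs) = f c cs - alt (λ d ds → f d (c ∷ ds)) cs

    -- Labels are arbitrary, so that renumbering permutes the lists and deleting a row or column
    -- shortens them. Lists of different lengths give 0, which lets `minor-transpose` hold for every
    -- pair of lists.
    minor : (I → J → Carrier) → List I → List J → Carrier
    minor M []       []       = 1#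
    minor M []       (_ ∷ _)  = 0#
    minor M (r ∷ rs) cs       = alt (λ c cs′ → M r c * minor M rs cs′) cs

    -- Only lists one shorter than `cs` occur in the sum; the induction on length in
    -- `minor-transpose` relies on this bound.
    alt-cong-length : {f g : I → List I → Carrier} (cs : List I) →
      (∀ d ds → suc (length ds) ≡ length cs → f d ds ≈ g d ds) → alt f cs ≈ alt g cs
    alt-cong-length []       eq = refl
    alt-cong-length (c ∷ cs) eq = +-cong (eq c cs ≡.refl)
      (-‿cong (alt-cong-length cs λ d ds e → eq d (c ∷ ds) (≡.cong suc e)))

    alt-cong : {f g : I → List I → Carrier} (cs : List I) →
      (∀ d ds → f d ds ≈ g d ds) → alt f cs ≈ alt g cs
    alt-cong cs eq = alt-cong-length cs λ d ds _ → eq d ds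

    alt-- : (f g : I → List I → Carrier) (cs : List I) →
      alt (λ d ds → f d ds - g d ds) cs ≈ alt f cs - alt g cs
    alt-- f g []       = sym (trans (+-congˡ -0#≈0#) (+-identityˡ 0#))
    alt-- f g (c ∷ cs) = trans (+-congˡ (-‿cong (alt-- (λ d ds → f d (c ∷ ds)) (λ d ds → g d (c ∷ ds)) cs)))
      (solve 4 (λ a b x y → a :- b :- (x :- y) := a :- x :- (b :- y)) refl _ _ _ _)

    alt-* : (a : Carrier) (f : I → List I → Carrier) (cs : List I) →
      alt (λ d ds → a * f d ds) cs ≈ a * alt f cs
    alt-* a f []       = sym (zeroʳ a)
    alt-* a f (c ∷ cs) = trans (+-congˡ (-‿cong (alt-* a (λ d ds → f d (c ∷ ds)) cs)))
      (solve 3 (λ a x y → a :* x :- (a :* y) := a :* (x :- y)) refl _ _ _)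

    alt-zero : (f : I → List I → Carrier) (cs : List I) →
      (∀ d ds → f d ds ≈ 0#) → alt f cs ≈ 0#
    alt-zero f []       f≈0 = refl
    alt-zero f (c ∷ cs) f≈0 = trans
      (+-cong (f≈0 c cs) (-‿cong (alt-zero (λ d ds → f d (c ∷ ds)) cs (λ d ds → f≈0 d (c ∷ ds)))))
      (-‿inverseʳ 0#)

    alt-map : (h : J → I) (f : I → List I → Carrier) (cs : List J) →
      alt f (List.map h cs) ≡ alt (λ d ds → f (h d) (List.map h ds)) cs
    alt-map h f []       = ≡.refl
    alt-map h f (c ∷ cs) = ≡.cong (λ v → f (h c) (List.map h cs) - v)
      (alt-map h (λ d ds → f d (h c ∷ ds)) cs)

    alt-comm : (F : I → List I → J → List J → Carrier) (xs : List I) (ys : List J) →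
      alt (λ a as → alt (λ b bs → F a as b bs) ys) xs ≈
      alt (λ b bs → alt (λ a as → F a as b bs) xs) ys
    alt-comm F []       ys = sym (alt-zero _ ys (λ _ _ → refl))
    alt-comm F (x ∷ xs) ys = trans (+-congˡ (-‿cong (alt-comm (λ a as → F a (x ∷ as)) xs ys)))
      (sym (alt-- _ _ ys))

    -- Removing first a and then b, or first b and then a, contributes with
    -- opposite signs.
    alt-antisym : (F : I → I → List I → Carrier) (cs : List I) →
      alt (λ a as → alt (λ b bs → F a b bs) as) cs ≈
      - alt (λ a as → alt (λ b bs → F b a bs) as) cs
    alt-antisym F []       = sym -0#≈0#
    alt-antisym F (c ∷ cs) = begin
      alt (F c) cs - alt (λ a as → alt (F a) (c ∷ as)) cs
        ≈⟨ +-congˡ (-‿cong (alt-- _ _ cs)) ⟩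
      alt (F c) cs - (alt (λ a → F a c) cs - alt (λ a as → alt (λ b bs → F a b (c ∷ bs)) as) cs)
        ≈⟨ +-congˡ (-‿cong (+-congˡ (-‿cong (alt-antisym (λ a b bs → F a b (c ∷ bs)) cs)))) ⟩
      alt (F c) cs - (alt (λ a → F a c) cs - - alt (λ a as → alt (λ b bs → F b a (c ∷ bs)) as) cs)
        ≈⟨ solve 3 (λ x y z → x :- (y :- (:- z)) := :- (y :- (x :- z))) refl _ _ _ ⟩
      - (alt (λ a → F a c) cs - (alt (F c) cs - alt (λ a as → alt (λ b bs → F b a (c ∷ bs)) as) cs))
        ≈⟨ -‿cong (+-congˡ (-‿cong (alt-- _ _ cs))) ⟨
      - (alt (λ a → F a c) cs - alt (λ a as → alt (λ b → F b a) (c ∷ as)) cs) ∎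

    minor-cong : {M N : I → J → Carrier} → (∀ r c → M r c ≈ N r c) →
      ∀ rs cs → minor M rs cs ≈ minor N rs cs
    minor-cong eq []       []      = refl
    minor-cong eq []       (_ ∷ _) = refl
    minor-cong eq (r ∷ rs) cs      = alt-cong cs λ d ds → *-cong (eq r d) (minor-cong eq rs ds)

    minor-map : ∀ {I′ J′ : Set} (M : I → J → Carrier) (h : I′ → I) (k : J′ → J) rs cs →
      minor M (List.map h rs) (List.map k cs) ≈ minor (λ r c → M (h r) (k c)) rs cs
    minor-map M h k []       []      = refl
    minor-map M h k []       (_ ∷ _) = refl
    minor-map M h k (r ∷ rs) cs      = trans (reflexive (alt-map k _ cs))
      (alt-cong cs λ d ds → *-congˡ (minor-map M h k rs ds))

    -- Expanding along the first row, and the resulting minors along the first column, leaves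
    -- besides the corner term a double sum over a row and a column in which the two play symmetric
    -- roles. The induction is on a bound for the number of rows, because it is also applied to
    -- lists `r ∷ ss` that are not tails of the given one.
    minor-transpose : (M : I → J → Carrier) (rs : List I) (cs : List J) →
      minor M rs cs ≈ minor (λ c r → M r c) cs rs
    minor-transpose {I} {J} M rs cs = go (length rs) rs cs ℕ.≤-refl
      where
      Mᵀ : J → I → Carrier
      Mᵀ c r = M r c

      go : ∀ n (rs : List I) (cs : List J) → length rs ≤ n → minor M rs cs ≈ minor Mᵀ cs rs
      go n       []       []       _ = refl
      go n       []       (_ ∷ _)  _ = refl
      go n       (_ ∷ _)  []       _ = refl
      go (suc n) (r ∷ rs) (c ∷ cs) (s≤s ∣rs∣≤n) = +-cong (*-congˡ (go n rs cs ∣rs∣≤n)) (-‿cong (begin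
        alt (λ d ds → M r d * minor M rs (c ∷ ds)) cs
          ≈⟨ alt-cong cs (λ d ds → trans (*-congˡ (go n rs (c ∷ ds) ∣rs∣≤n)) (sym (alt-* (M r d) _ rs))) ⟩
        alt (λ d ds → alt (λ s ss → M r d * (M s c * minor Mᵀ ds ss)) rs) cs
          ≈⟨ alt-comm _ cs rs ⟩
        alt (λ s ss → alt (λ d ds → M r d * (M s c * minor Mᵀ ds ss)) cs) rs
          ≈⟨ alt-cong-length rs (λ s ss ∣ss∣ → trans
               (alt-cong cs λ d ds → trans
                 (solve 3 (λ a b z → a :* (b :* z) := b :* (a :* z)) refl _ _ _)
                 (*-congˡ (*-congˡ (sym (go n ss ds (ℕ.≤-trans (ℕ.n≤1+n _) (∣r∷ss∣≤n ∣ss∣)))))))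
               (trans (alt-* (M s c) _ cs) (*-congˡ (go n (r ∷ ss) cs (∣r∷ss∣≤n ∣ss∣))))) ⟩
        alt (λ s ss → M s c * minor Mᵀ cs (r ∷ ss)) rs ∎))
        where
        ∣r∷ss∣≤n : ∀ {l} → l ≡ length rs → l ≤ n
        ∣r∷ss∣≤n ≡.refl = ∣rs∣≤n

    swap-rows : (M : I → J → Carrier) (r s : I) (rs : List I) (cs : List J) →
      minor M (r ∷ s ∷ rs) cs ≈ - minor M (s ∷ r ∷ rs) cs
    swap-rows M r s rs cs = begin
      alt (λ a as → M r a * alt (λ b bs → M s b * minor M rs bs) as) cs
        ≈⟨ alt-cong cs (λ a as → sym (alt-* (M r a) _ as)) ⟩
      alt (λ a as → alt (λ b bs → M r a * (M s b * minor M rs bs)) as) cs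
        ≈⟨ alt-antisym (λ a b bs → M r a * (M s b * minor M rs bs)) cs ⟩
      - alt (λ a as → alt (λ b bs → M r b * (M s a * minor M rs bs)) as) cs
        ≈⟨ -‿cong (alt-cong cs λ a as → trans
             (alt-cong as λ b bs → solve 3 (λ x y z → x :* (y :* z) := y :* (x :* z)) refl _ _ _)
             (alt-* (M s a) _ as)) ⟩
      - alt (λ a as → M s a * alt (λ b bs → M r b * minor M rs bs) as) cs ∎

    -- Of the sign of the permutation only ε² = 1 is recorded. One ε serves all matrices and all
    -- column lists, so in `minor-↭` it occurs once for the rows and, through the transpose, once
    -- for the columns, and cancels.
    permute-rows : ∀ {rs rs′ : List I} → rs ↭ rs′ → ∃[ ε ] ε * ε ≈ 1# ×
      (∀ {J : Set} (M : I → J → Carrier) cs → minor M rs′ cs ≈ ε * minor M rs cs)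
    permute-rows Perm.refl = 1# , *-identityˡ 1# , λ M cs → sym (*-identityˡ _)
    permute-rows (Perm.prep x p) with permute-rows p
    ... | ε , ε² , eq = ε , ε² , λ M cs → trans
      (alt-cong cs λ d ds → trans (*-congˡ (eq M ds))
        (solve 3 (λ m e z → m :* (e :* z) := e :* (m :* z)) refl _ _ _))
      (alt-* ε _ cs)
    permute-rows (Perm.swap {xs = rs} {ys = rs′} x y p) with permute-rows p
    ... | ε , ε² , eq = - ε
        , trans (solve 1 (λ e → :- e :* :- e := e :* e) refl ε) ε²
        , λ M cs → begin
            minor M (y ∷ x ∷ rs′) cs         ≈⟨ swap-rows M y x rs′ cs ⟩
            - minor M (x ∷ y ∷ rs′) cs
              ≈⟨ -‿cong (trans
                   (alt-cong cs λ a as → trans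
                     (*-congˡ (trans (alt-cong as λ b bs → trans (*-congˡ (eq M bs)) (exchange _ _ _))
                                     (alt-* ε _ as)))
                     (exchange _ _ _))
                   (alt-* ε _ cs)) ⟩
            - (ε * minor M (x ∷ y ∷ rs) cs)  ≈⟨ -‿distribˡ-* _ _ ⟩
            - ε * minor M (x ∷ y ∷ rs) cs    ∎
      where
      exchange : ∀ a b c → a * (b * c) ≈ b * (a * c)
      exchange = solve 3 (λ m e z → m :* (e :* z) := e :* (m :* z)) refl
    permute-rows (Perm.trans p q) with permute-rows p | permute-rows q
    ... | ε , ε² , eq | δ , δ² , eq′ = δ * ε
      , trans (solve 2 (λ d e → (d :* e) :* (d :* e) := (d :* d) :* (e :* e)) refl δ ε)
              (trans (*-cong δ² ε²) (*-identityˡ 1#))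
      , λ M cs → trans (eq′ M cs) (trans (*-congˡ (eq M cs)) (sym (*-assoc δ ε _)))

    minor-↭ : (M : I → I → Carrier) {rs rs′ : List I} → rs ↭ rs′ →
      minor M rs′ rs′ ≈ minor M rs rs
    minor-↭ M {rs} {rs′} p with permute-rows p
    ... | ε , ε² , eq = begin
      minor M rs′ rs′                        ≈⟨ eq M rs′ ⟩
      ε * minor M rs rs′                     ≈⟨ *-congˡ (minor-transpose M rs rs′) ⟩
      ε * minor (λ c r → M r c) rs′ rs       ≈⟨ *-congˡ (eq _ rs) ⟩
      ε * (ε * minor (λ c r → M r c) rs rs)  ≈⟨ *-assoc ε ε _ ⟨
      ε * ε * minor (λ c r → M r c) rs rs    ≈⟨ *-cong ε² (sym (minor-transpose M rs rs)) ⟩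
      1# * minor M rs rs                     ≈⟨ *-identityˡ _ ⟩
      minor M rs rs                          ∎

    -- The source is a raw ring, so that polynomials can be mapped to dual numbers without ring laws
    -- for coefficient lists.
    record IsHomomorphism (R : RawRing 0ℓ 0ℓ) (φ : RawRing.Carrier R → Carrier) : Set where
      private module R = RawRing R
      field
        +-homo : ∀ x y → φ (x R.+ y) ≈ φ x + φ y
        *-homo : ∀ x y → φ (x R.* y) ≈ φ x * φ y
        -‿homo : ∀ x → φ (R.- x) ≈ - φ x
        0#-homo : φ R.0# ≈ 0#
        1#-homo : φ R.1# ≈ 1#

    module _ (R : RawRing 0ℓ 0ℓ) (φ : RawRing.Carrier R → Carrier) (homo : IsHomomorphism R φ) where
      private module R = RawRing R
      open RawSemiringOps R.rawSemiring using () renaming (sum to ∑; _^_ to _^ᴿ_)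
      open IsHomomorphism homo
      open SemiringExp semiring using (_^_; ^-congˡ)

      ^-homo : ∀ x k → φ (x ^ᴿ k) ≈ φ x ^ k
      ^-homo x zero    = 1#-homo
      ^-homo x (suc k) = trans (*-homo _ _) (*-congˡ (^-homo x k))

      private
        -- ε is the sign of the first column that is left.
        homo-expansion : ∀ {n} (ε : Carrier) (F : J → List J → Carrier) (g : Fin (suc n) → J)
          (e : Fin (suc n) → R.Carrier) →
          (∀ j → φ (e j) ≈ ε * ((- 1#) ^ toℕ j * F (g j) (tabulate (g ∘ punchIn j)))) →
          φ (∑ e) ≈ ε * alt F (tabulate g)
        homo-expansion {n = zero} ε F g e eq = begin
          φ (e zero R.+ R.0#)                   ≈⟨ +-homo _ _ ⟩
          φ (e zero) + φ R.0#                   ≈⟨ +-cong (eq zero) 0#-homo ⟩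
          ε * (1# * F (g zero) []) + 0#         ≈⟨ trans (+-identityʳ _) (*-congˡ (*-identityˡ _)) ⟩
          ε * F (g zero) []                     ≈⟨ *-congˡ (trans (+-congˡ -0#≈0#) (+-identityʳ _)) ⟨
          ε * (F (g zero) [] - 0#)              ∎
        homo-expansion {n = suc n} ε F g e eq = begin
          φ (e zero R.+ ∑ (e ∘ suc))
            ≈⟨ +-homo _ _ ⟩
          φ (e zero) + φ (∑ (e ∘ suc))
            ≈⟨ +-cong (eq zero) (homo-expansion (- ε) F′ (g ∘ suc) (e ∘ suc) λ j → trans (eq (suc j))
                 (trans (solve 4 (λ a u p x → a :* (:- u :* p :* x) := :- a :* (u :* p :* x)) refl _ _ _ _)
                        (*-congˡ (*-congʳ (*-identityˡ _))))) ⟩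
          ε * (1# * F (g zero) (tabulate (g ∘ suc))) + - ε * alt F′ (tabulate (g ∘ suc))
            ≈⟨ +-congʳ (*-congˡ (*-identityˡ _)) ⟩
          ε * F (g zero) (tabulate (g ∘ suc)) + - ε * alt F′ (tabulate (g ∘ suc))
            ≈⟨ solve 3 (λ a x y → a :* x :+ (:- a) :* y := a :* (x :- y)) refl _ _ _ ⟩
          ε * (F (g zero) (tabulate (g ∘ suc)) - alt F′ (tabulate (g ∘ suc))) ∎
          where F′ = λ d ds → F d (g zero ∷ ds)

      -- The labellings are arbitrary so that the induction can continue: deleting column `j`
      -- replaces `g` by `g ∘ punchIn j`.
      homo-det : ∀ {n} (N : Matrix R.Carrier n) (M : I → J → Carrier) (f : Fin n → I) (g : Fin n → J) →
        (∀ i j → φ (N i j) ≈ M (f i) (g j)) → φ (det R N) ≈ minor M (tabulate f) (tabulate g)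
      homo-det {n = zero}  N M f g eq = 1#-homo
      homo-det {n = suc n} N M f g eq = trans
        (homo-expansion 1# (λ d ds → M (f zero) d * minor M (tabulate (f ∘ suc)) ds) g _ λ j → begin
          φ (((R.- R.1#) ^ᴿ toℕ j R.* N zero j) R.* det R (λ r → removeAt (N (suc r)) j))
            ≈⟨ trans (*-homo _ _) (*-congʳ (*-homo _ _)) ⟩
          φ ((R.- R.1#) ^ᴿ toℕ j) * φ (N zero j) * φ (det R (λ r → removeAt (N (suc r)) j))
            ≈⟨ *-cong (*-cong (trans (^-homo _ (toℕ j)) (^-congˡ (toℕ j) (trans (-‿homo _) (-‿cong 1#-homo))))
                              (eq zero j))
                 (homo-det (λ r → removeAt (N (suc r)) j) M (f ∘ suc) (g ∘ punchIn j)
                   (λ r c → eq (suc r) (punchIn j c))) ⟩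
          (- 1#) ^ toℕ j * M (f zero) (g j) * minor M (tabulate (f ∘ suc)) (tabulate (g ∘ punchIn j))
            ≈⟨ trans (*-assoc _ _ _) (sym (*-identityˡ _)) ⟩
          1# * ((- 1#) ^ toℕ j * (M (f zero) (g j) * minor M (tabulate (f ∘ suc)) (tabulate (g ∘ punchIn j)))) ∎)
        (*-identityˡ _)

-- Determinants of band matrices: continuants and the cycle.

module SparseDeterminants where

  open import Algebra.Bundles using (CommutativeRing)
  import Algebra.Properties.Ring as RingProperties
  open import Data.List.Base as List using (List; []; _∷_; _++_; length; [_])
  open import Data.List.Relation.Unary.All as All using (All; []; _∷_)
  open import Data.List.Relation.Binary.Permutation.Propositional as Perm using (_↭_)
  open import Data.List.Relation.Binary.Permutation.Propositional.Properties using (∷↭∷ʳ)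
  open import Data.Nat.Base as ℕ using (ℕ; zero; suc; _≤_; _<_; s≤s; z≤n)
  import Data.Nat.Properties as ℕ
  open import Data.Product.Base using (_,_; ∃-syntax)
  open import Level using (0ℓ)
  open import Relation.Binary.PropositionalEquality as ≡ using (_≡_)
  import Relation.Binary.Reasoning.Setoid as SetoidReasoning
  open IntegerSolver
  open Determinants

  segment : ℕ → ℕ → List ℕ
  segment a zero    = []
  segment a (suc m) = a ∷ segment (suc a) m

  All-segment : ∀ {P : ℕ → Set} a m → (∀ {i} → a ≤ i → i < a ℕ.+ m → P i) → All P (segment a m)
  All-segment a zero    p = []
  All-segment a (suc m) p = p ℕ.≤-refl (ℕ.m<m+n a (s≤s z≤n))
    ∷ All-segment (suc a) m λ a<i i< → p (ℕ.<⇒≤ a<i) (ℕ.<-≤-trans i< (ℕ.≤-reflexive (≡.sym (ℕ.+-suc a m))))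

  segment-∷ʳ : ∀ a m → segment a m ++ [ a ℕ.+ m ] ≡ segment a (suc m)
  segment-∷ʳ a zero    = ≡.cong [_] (ℕ.+-identityʳ a)
  segment-∷ʳ a (suc m) = ≡.cong (a ∷_) (≡.trans
    (≡.cong (λ b → segment (suc a) m ++ [ b ]) (ℕ.+-suc a m)) (segment-∷ʳ (suc a) m))

  module SparseDeterminant (S : CommutativeRing 0ℓ 0ℓ) where

    open CommutativeRing S hiding (zero)
    open RingProperties ring using (-0#≈0#; -‿distribʳ-*)
    open SetoidReasoning setoid
    open IntegerCoefficients S
    open Determinant S

    private
      variable
        I J : Set

    alt-zero-All : {f : I → List I → Carrier} {cs : List I} →
      All (λ d → ∀ ds → f d ds ≈ 0#) cs → alt f cs ≈ 0#
    alt-zero-All []                      = refl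
    alt-zero-All {cs = c ∷ cs} (p ∷ ps) = trans
      (+-cong (p cs) (-‿cong (alt-zero-All (All.map (λ q ds → q (c ∷ ds)) ps))))
      (-‿inverseʳ 0#)

    module _ (M : I → J → Carrier) where

      expand-row₁ : ∀ {r} rs {c cs} → All (λ d → M r d ≈ 0#) cs →
        minor M (r ∷ rs) (c ∷ cs) ≈ M r c * minor M rs cs
      expand-row₁ rs ps = trans
        (+-congˡ (trans (-‿cong (alt-zero-All (All.map (λ p ds → trans (*-congʳ p) (zeroˡ _)) ps))) -0#≈0#))
        (+-identityʳ _)

      expand-row₂ : ∀ {r} rs {c d cs} → All (λ e → M r e ≈ 0#) cs →
        minor M (r ∷ rs) (c ∷ d ∷ cs) ≈
        M r c * minor M rs (d ∷ cs) - M r d * minor M rs (c ∷ cs)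
      expand-row₂ rs ps = +-congˡ (-‿cong (trans
        (+-congˡ (trans (-‿cong (alt-zero-All (All.map (λ p ds → trans (*-congʳ p) (zeroˡ _)) ps))) -0#≈0#))
        (+-identityʳ _)))

      expand-row₃ : ∀ {r} rs {c d e cs} → All (λ e → M r e ≈ 0#) cs →
        minor M (r ∷ rs) (c ∷ d ∷ e ∷ cs) ≈
        M r c * minor M rs (d ∷ e ∷ cs) - (M r d * minor M rs (c ∷ e ∷ cs) - M r e * minor M rs (c ∷ d ∷ cs))
      expand-row₃ rs ps = +-congˡ (-‿cong (+-congˡ (-‿cong (trans
        (+-congˡ (trans (-‿cong (alt-zero-All (All.map (λ p ds → trans (*-congʳ p) (zeroˡ _)) ps))) -0#≈0#))
        (+-identityʳ _)))))

    module _ (M : I → J → Carrier) where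

      private
        Mᵀ : J → I → Carrier
        Mᵀ c r = M r c

      expand-column₁ : ∀ {r rs c} cs → All (λ s → M s c ≈ 0#) rs →
        minor M (r ∷ rs) (c ∷ cs) ≈ M r c * minor M rs cs
      expand-column₁ {r} {rs} {c} cs ps = trans (minor-transpose M (r ∷ rs) (c ∷ cs))
        (trans (expand-row₁ Mᵀ cs ps) (*-congˡ (sym (minor-transpose M rs cs))))

      expand-column₂ : ∀ {r s rs c} cs → All (λ s → M s c ≈ 0#) rs →
        minor M (r ∷ s ∷ rs) (c ∷ cs) ≈ M r c * minor M (s ∷ rs) cs - M s c * minor M (r ∷ rs) cs
      expand-column₂ {r} {s} {rs} {c} cs ps = trans (minor-transpose M (r ∷ s ∷ rs) (c ∷ cs))
        (trans (expand-row₂ Mᵀ cs ps) (+-cong (*-congˡ (sym (minor-transpose M (s ∷ rs) cs)))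
          (-‿cong (*-congˡ (sym (minor-transpose M (r ∷ rs) cs))))))

    -- Multiplication by (-1)^k, kept as iterated negation so that signs can be followed by
    -- recursion on k.
    negate : ℕ → Carrier → Carrier
    negate zero    y = y
    negate (suc k) y = - negate k y

    negate-cong : ∀ k {y z} → y ≈ z → negate k y ≈ negate k z
    negate-cong zero    eq = eq
    negate-cong (suc k) eq = -‿cong (negate-cong k eq)

    *-negate : ∀ k x y → x * negate k y ≈ negate k (x * y)
    *-negate zero    x y = refl
    *-negate (suc k) x y = trans (sym (-‿distribʳ-* x _)) (-‿cong (*-negate k x y))

    alt-negate : ∀ k (f : I → List I → Carrier) cs →
      alt (λ d ds → negate k (f d ds)) cs ≈ negate k (alt f cs)
    alt-negate zero    f cs = refl
    alt-negate (suc k) f cs = begin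
      alt (λ d ds → - negate k (f d ds)) cs         ≈⟨ alt-cong cs (λ d ds → solve 1 (λ a → :- a := :- con 1ℤ :* a) refl _) ⟩
      alt (λ d ds → - 1′ * negate k (f d ds)) cs    ≈⟨ alt-* (- 1′) _ cs ⟩
      - 1′ * alt (λ d ds → negate k (f d ds)) cs    ≈⟨ solve 1 (λ a → :- con 1ℤ :* a := :- a) refl _ ⟩
      - alt (λ d ds → negate k (f d ds)) cs         ≈⟨ -‿cong (alt-negate k f cs) ⟩
      - negate k (alt f cs)                         ∎
      where
      open import Data.Integer.Base using (1ℤ)
      1′ = fromℤ 1ℤ

    -- The row `r` passes each row of `rs` once, every time by an adjacent transposition.
    rotate-rows : (M : I → J → Carrier) (r : I) (rs : List I) (cs : List J) →
      minor M (r ∷ rs) cs ≈ negate (length rs) (minor M (rs ++ [ r ]) cs)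
    rotate-rows M r []       cs = refl
    rotate-rows M r (s ∷ rs) cs = begin
      minor M (r ∷ s ∷ rs) cs    ≈⟨ swap-rows M r s rs cs ⟩
      - minor M (s ∷ r ∷ rs) cs
        ≈⟨ -‿cong (trans (alt-cong cs λ d ds → trans (*-congˡ (rotate-rows M r rs ds)) (*-negate (length rs) _ _))
                         (alt-negate (length rs) _ cs)) ⟩
      - negate (length rs) (minor M (s ∷ rs ++ [ r ]) cs) ∎

    length-segment : ∀ a m → length (segment a m) ≡ m
    length-segment a zero    = ≡.refl
    length-segment a (suc m) = ≡.cong suc (length-segment (suc a) m)

    -- Indices are positions along the cycle. In the application the common diagonal entry `x` is
    -- the class of X modulo X².
    module SymmetricBanded (N : ℕ → ℕ → Carrier) (N-sym : ∀ i j → N i j ≈ N j i)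
      (x : Carrier) (N-diag : ∀ i → N i i ≈ x) where

      -- Constraining the entries above the diagonal is enough, since `N` is symmetric.
      Tridiagonal : ℕ → ℕ → Set
      Tridiagonal a b = ∀ {i j} → a ≤ i → suc i < j → j < b → N i j ≈ 0#

      tridiagonal-suc : ∀ {a b} → Tridiagonal a b → Tridiagonal (suc a) b
      tridiagonal-suc t a<i = t (ℕ.<⇒≤ a<i)

      continuant : ℕ → ℕ → Carrier
      continuant a m = minor N (segment a m) (segment a m)

      superdiagonal : ℕ → ℕ → Carrier
      superdiagonal a zero    = 1#
      superdiagonal a (suc m) = N a (suc a) * superdiagonal (suc a) m

      continuant-1 : ∀ a → continuant a 1 ≈ x
      continuant-1 a = trans (expand-row₁ N [] []) (trans (*-identityʳ _) (N-diag a))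

      -- The first row has two possibly nonzero entries. In the minor belonging to the second one,
      -- the first column has a single such entry left, which by symmetry supplies the second factor
      -- of the square.
      continuant-step : ∀ a m → Tridiagonal a (a ℕ.+ suc (suc m)) →
        continuant a (suc (suc m)) ≈
        x * continuant (suc a) (suc m) - N a (suc a) * N a (suc a) * continuant (suc (suc a)) m
      continuant-step a m t = begin
        continuant a (suc (suc m))
          ≈⟨ expand-row₂ N (segment (suc a) (suc m)) zeros ⟩
        N a a * continuant (suc a) (suc m) -
        N a (suc a) * minor N (suc a ∷ segment (2 ℕ.+ a) m) (a ∷ segment (2 ℕ.+ a) m)
          ≈⟨ +-cong (*-congʳ (N-diag a)) (-‿cong (*-congˡ (trans
               (expand-column₁ N (segment (2 ℕ.+ a) m) (All.map (trans (N-sym _ a)) zeros))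
               (*-congʳ (N-sym (suc a) a))))) ⟩
        x * continuant (suc a) (suc m) - N a (suc a) * (N a (suc a) * continuant (2 ℕ.+ a) m)
          ≈⟨ +-congˡ (-‿cong (*-assoc _ _ _)) ⟨
        x * continuant (suc a) (suc m) - N a (suc a) * N a (suc a) * continuant (2 ℕ.+ a) m ∎
        where
        zeros : All (λ j → N a j ≈ 0#) (segment (2 ℕ.+ a) m)
        zeros = All-segment (2 ℕ.+ a) m λ {j} a+2≤j j< → t ℕ.≤-refl a+2≤j
          (ℕ.<-≤-trans j< (ℕ.≤-reflexive (≡.sym (≡.trans (ℕ.+-suc a (suc m)) (≡.cong suc (ℕ.+-suc a m))))))

      -- With the columns shifted by one position the matrix is lower triangular, and the
      -- superdiagonal entries of `N` are its diagonal.
      minor-superdiagonal : ∀ a m → Tridiagonal a (suc a ℕ.+ m) →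
        minor N (segment a m) (segment (suc a) m) ≈ superdiagonal a m
      minor-superdiagonal a zero    t = refl
      minor-superdiagonal a (suc m) t = trans
        (expand-row₁ N (segment (suc a) m) (All-segment (2 ℕ.+ a) m λ a+2≤j j< → t ℕ.≤-refl a+2≤j
          (ℕ.<-≤-trans j< bound)))
        (*-congˡ (minor-superdiagonal (suc a) m λ a<i i<j j< → t (ℕ.<⇒≤ a<i) i<j (ℕ.<-≤-trans j< bound)))
        where
        bound : suc (suc a) ℕ.+ m ≤ suc a ℕ.+ suc m
        bound = ℕ.≤-reflexive (≡.sym (≡.cong suc (ℕ.+-suc a m)))

      -- Expansion along row and column 0, whose only off-diagonal entries
      -- are those of the neighbours 1 and z = m + 2.
      private
        cross : ℕ → Carrier
        cross m = negate m (N 0 1 * N 0 (2 ℕ.+ m) * superdiagonal 1 (suc m))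

      -- The squared terms belong to the two 2-cycles through 0, each with the continuant of the
      -- remaining path; the two copies of `cross` belong to the two orientations of the whole
      -- cycle. The cofactor `y` stays unspecified: its factor `x` has constant coefficient 0 in the
      -- application, so it drops out.
      cycle-determinant : ∀ m → (let z = 2 ℕ.+ m) → Tridiagonal 1 (suc z) →
        (∀ {j} → 2 ≤ j → j < z → N 0 j ≈ 0#) →
        ∃[ y ] minor N (segment 0 (suc z)) (segment 0 (suc z)) ≈
          x * y - (N 0 1 * N 0 1 * continuant 2 (suc m) + N 0 z * N 0 z * continuant 1 (suc m))
            + (cross m + cross m)
      cycle-determinant m t zeros = y , (begin
        minor N (segment 0 (3 ℕ.+ m)) (segment 0 (3 ℕ.+ m))
          -- Bringing the neighbours 1 and z of 0 to the front puts all nonzero entries of row and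
          -- column 0 into leading positions, as the sparse expansions require.
          ≈⟨ minor-↭ N order ⟨
        minor N (0 ∷ 1 ∷ z ∷ rest) (0 ∷ 1 ∷ z ∷ rest)
          ≈⟨ expand-row₃ N (1 ∷ z ∷ rest) row ⟩
        N 0 0 * y - (N 0 1 * minor N (1 ∷ z ∷ rest) (0 ∷ z ∷ rest)
                     - N 0 z * minor N (1 ∷ z ∷ rest) (0 ∷ 1 ∷ rest))
          ≈⟨ +-cong (*-congʳ (N-diag 0)) (-‿cong (+-cong (*-congˡ (expand-column₂ N (z ∷ rest) column))
               (-‿cong (*-congˡ (expand-column₂ N (1 ∷ rest) column))))) ⟩
        x * y - (N 0 1 * (N 1 0 * D (z ∷ rest) (z ∷ rest) - N z 0 * D (1 ∷ rest) (z ∷ rest))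
                 - N 0 z * (N 1 0 * D (z ∷ rest) (1 ∷ rest) - N z 0 * D (1 ∷ rest) (1 ∷ rest)))
          ≈⟨ +-congˡ (-‿cong (+-cong
               (*-congˡ (+-cong (*-cong (N-sym 1 0) (minor-↭ N last)) (-‿cong (*-cong (N-sym z 0) mixed))))
               (-‿cong (*-congˡ (+-cong (*-cong (N-sym 1 0) mixed′) (-‿cong (*-congʳ (N-sym z 0)))))))) ⟩
        x * y - (w * (w * K₂ - c * Q) - c * (w * Q - c * K₁))
          ≈⟨ solve 6 (λ w c k₁ k₂ q u → u :- (w :* (w :* k₂ :- c :* q) :- c :* (w :* q :- c :* k₁)) :=
               u :- (w :* w :* k₂ :+ c :* c :* k₁) :+ (w :* c :* q :+ w :* c :* q)) refl w c K₁ K₂ Q (x * y) ⟩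
        x * y - (w * w * K₂ + c * c * K₁) + (w * c * Q + w * c * Q)
          ≈⟨ +-congˡ (+-cong (*-negate m _ _) (*-negate m _ _)) ⟩
        x * y - (w * w * K₂ + c * c * K₁)
          + (negate m (w * c * superdiagonal 1 (suc m)) + negate m (w * c * superdiagonal 1 (suc m))) ∎)
        where
        z = 2 ℕ.+ m
        rest = segment 2 m
        D = minor N
        y = minor N (1 ∷ z ∷ rest) (1 ∷ z ∷ rest)
        w = N 0 1
        c = N 0 z
        K₁ = continuant 1 (suc m)
        K₂ = continuant 2 (suc m)
        Q = negate m (superdiagonal 1 (suc m))

        last : segment 2 (suc m) ↭ z ∷ rest
        last = ≡.subst (_↭ z ∷ rest) (segment-∷ʳ 2 m) (Perm.↭-sym (∷↭∷ʳ z rest))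

        order : segment 0 (3 ℕ.+ m) ↭ 0 ∷ 1 ∷ z ∷ rest
        order = Perm.prep 0 (Perm.prep 1 last)

        row : All (λ j → N 0 j ≈ 0#) rest
        row = All-segment 2 m zeros

        column : All (λ i → N i 0 ≈ 0#) rest
        column = All.map (trans (N-sym _ 0)) row

        mixed′ : D (z ∷ rest) (1 ∷ rest) ≈ Q
        mixed′ = begin
          D (z ∷ rest) (1 ∷ rest)
            -- Row z moves behind the m rows of `rest`. This leaves rows 2 to m + 2 against columns
            -- 1 to m + 1, the transpose of a triangular minor.
            ≈⟨ rotate-rows N z rest (1 ∷ rest) ⟩
          negate (length rest) (D (rest ++ [ z ]) (1 ∷ rest))
            ≡⟨ ≡.cong₂ (λ k rs → negate k (D rs (1 ∷ rest))) (length-segment 2 m) (segment-∷ʳ 2 m) ⟩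
          negate m (D (segment 2 (suc m)) (segment 1 (suc m)))
            ≈⟨ negate-cong m (trans (minor-transpose N (segment 2 (suc m)) (segment 1 (suc m)))
                 (trans (minor-cong (λ i j → N-sym j i) (segment 1 (suc m)) (segment 2 (suc m)))
                        (minor-superdiagonal 1 (suc m) t))) ⟩
          Q ∎

        mixed : D (1 ∷ rest) (z ∷ rest) ≈ Q
        mixed = trans (minor-transpose N (1 ∷ rest) (z ∷ rest))
          (trans (minor-cong (λ i j → N-sym j i) (z ∷ rest) (1 ∷ rest)) mixed′)

-- The reals form a commutative ring.

module Reals where

  open import Algebra.Bundles using (CommutativeRing; RawRing)
  open import Data.Nat.Base as ℕ using (ℕ; zero)
  import Data.Nat.Properties as ℕ
  open import Data.Rational.Base as ℚ using (ℚ; 0ℚ; 1ℚ; ½)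
  import Data.Rational.Properties as ℚ
  open import Data.Product.Base using (_×_; _,_; ∃-syntax; proj₁; proj₂)
  open import Level using (0ℓ)
  open import Relation.Binary.PropositionalEquality as ≡ using (_≡_; refl; cong; subst; sym; trans)
  open import Defs
  open IntegerSolver

  eventually-× : ∀ {A B C : ℕ → Set} → (∀ {n} → A n → B n → C n) →
    Eventually A → Eventually B → Eventually C
  eventually-× f (M , a) (N , b) = M ℕ.⊔ N , λ n ≤n →
    f (a n (ℕ.m⊔n≤o⇒m≤o M N ≤n)) (b n (ℕ.m⊔n≤o⇒n≤o M N ≤n))

  eventually-map : ∀ {A B : ℕ → Set} → (∀ {n} → A n → B n) → Eventually A → Eventually B
  eventually-map f (M , a) = M , λ n ≤n → f (a n ≤n)

  ½-positive : ∀ {ε} → 0ℚ ℚ.< ε → 0ℚ ℚ.< ½ ℚ.* ε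
  ½-positive = ℚ.*-monoʳ-<-pos ½

  ½+½ : ∀ ε → ½ ℚ.* ε ℚ.+ ½ ℚ.* ε ≡ ε
  ½+½ ε = trans (sym (ℚ.*-distribʳ-+ ε ½ ½)) (ℚ.*-identityˡ ε)

  *-positive : ∀ {p q} → 0ℚ ℚ.< p → 0ℚ ℚ.< q → 0ℚ ℚ.< p ℚ.* q
  *-positive {p} {q} 0<p 0<q = ℚ.positive⁻¹ _ ⦃ ℚ.pos*pos⇒pos p ⦃ ℚ.positive 0<p ⦄ q ⦃ ℚ.positive 0<q ⦄ ⦄

  -- Stated over an abstract ring, although needed only at ℚ: the solver run at ℚ
  -- itself would unfold the rational arithmetic.
  module DifferenceIdentities (S : CommutativeRing 0ℓ 0ℓ) where
    open CommutativeRing S hiding (sym; trans; refl; zero)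
    open CommutativeRing S using () renaming (refl to ≈-refl)
    open IntegerCoefficients S

    split : ∀ p q → p ≈ p - q + q
    split = solve 2 (λ p q → p := p :- q :+ q) ≈-refl

    reverse : ∀ p q → - (p - q) ≈ q - p
    reverse = solve 2 (λ p q → :- (p :- q) := q :- p) ≈-refl

    telescope : ∀ p q r → (p - q) + (q - r) ≈ p - r
    telescope = solve 3 (λ p q r → (p :- q) :+ (q :- r) := p :- r) ≈-refl

    +-difference : ∀ p q r s → (p - q) + (r - s) ≈ (p + r) - (q + s)
    +-difference = solve 4 (λ p q r s → (p :- q) :+ (r :- s) := (p :+ r) :- (q :+ s)) ≈-refl

    *-difference : ∀ p q r s → (p - q) * r + (r - s) * q ≈ p * r - q * s
    *-difference = solve 4 (λ p q r s → (p :- q) :* r :+ (r :- s) :* q := p :* r :- q :* s) ≈-refl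

    neg-difference : ∀ p q → - (p - q) ≈ (- p) - (- q)
    neg-difference = solve 2 (λ p q → :- (p :- q) := (:- p) :- (:- q)) ≈-refl

  open DifferenceIdentities ℚ.+-*-commutativeRing

  -- `x ≃ y` unfolds to this property of the termwise difference, so congruence laws reduce to
  -- closure properties of null sequences.
  IsNull : (ℕ → ℚ) → Set
  IsNull s = ∀ ε → 0ℚ ℚ.< ε → Eventually λ n → ℚ.∣ s n ∣ ℚ.< ε

  null-cong : ∀ {s t} → (∀ n → s n ≡ t n) → IsNull s → IsNull t
  null-cong eq null ε 0<ε = eventually-map (λ {n} → subst (λ q → ℚ.∣ q ∣ ℚ.< ε) (eq n)) (null ε 0<ε)

  null-0 : IsNull (λ _ → 0ℚ)
  null-0 ε 0<ε = 0 , λ _ _ → 0<ε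

  null-neg : ∀ {s} → IsNull s → IsNull (λ n → ℚ.- s n)
  null-neg {s} null ε 0<ε = eventually-map (λ {n} → subst (ℚ._< ε) (sym (ℚ.∣-p∣≡∣p∣ (s n)))) (null ε 0<ε)

  null-+ : ∀ {s t} → IsNull s → IsNull t → IsNull (λ n → s n ℚ.+ t n)
  null-+ {s} {t} s→0 t→0 ε 0<ε = eventually-×
    (λ {n} p q → ℚ.≤-<-trans (ℚ.∣p+q∣≤∣p∣+∣q∣ (s n) (t n)) (subst (_ ℚ.<_) (½+½ ε) (ℚ.+-mono-< p q)))
    (s→0 _ (½-positive 0<ε)) (t→0 _ (½-positive 0<ε))

  seq-bounded : ∀ x → ∃[ K ] 0ℚ ℚ.< K × Eventually (λ n → ℚ.∣ seq x n ∣ ℚ.< K)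
  seq-bounded x with cauchy x 1ℚ (ℚ.positive⁻¹ 1ℚ)
  ... | N , close = 1ℚ ℚ.+ ℚ.∣ seq x N ∣
    , ℚ.+-mono-<-≤ (ℚ.positive⁻¹ 1ℚ) (ℚ.0≤∣p∣ (seq x N))
    , N , λ n N≤n → ℚ.≤-<-trans
        (ℚ.≤-trans (ℚ.≤-reflexive (cong ℚ.∣_∣ (split (seq x n) (seq x N))))
                   (ℚ.∣p+q∣≤∣p∣+∣q∣ (seq x n ℚ.- seq x N) (seq x N)))
        (ℚ.+-monoˡ-< ℚ.∣ seq x N ∣ (close n N N≤n ℕ.≤-refl))

  reciprocal : ∀ K → 0ℚ ℚ.< K → ∃[ L ] 0ℚ ℚ.< L × L ℚ.* K ≡ 1ℚ
  reciprocal K 0<K = (ℚ.1/ K) ⦃ ℚ.>-nonZero 0<K ⦄ , ℚ.positive⁻¹ _ ⦃ ℚ.1/pos⇒pos K ⦃ ℚ.positive 0<K ⦄ ⦄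
    , ℚ.*-inverseˡ K ⦃ ℚ.>-nonZero 0<K ⦄

  quotient : ∀ {ε K} → 0ℚ ℚ.< ε → 0ℚ ℚ.< K → ∃[ δ ] 0ℚ ℚ.< δ × δ ℚ.* K ≡ ε
  quotient {ε} {K} 0<ε 0<K = ε ℚ.* L , *-positive {ε} {L} 0<ε 0<L
    , trans (ℚ.*-assoc ε L K) (trans (cong (ε ℚ.*_) LK≡1) (ℚ.*-identityʳ ε))
    where
    L = proj₁ (reciprocal K 0<K)
    0<L = proj₁ (proj₂ (reciprocal K 0<K))
    LK≡1 = proj₂ (proj₂ (reciprocal K 0<K))

  ∣*∣-small : ∀ {p q δ K ε} → 0ℚ ℚ.< K → δ ℚ.* K ≡ ε →
    ℚ.∣ p ∣ ℚ.< δ → ℚ.∣ q ∣ ℚ.< K → ℚ.∣ p ℚ.* q ∣ ℚ.< ε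
  ∣*∣-small {p} {q} {δ} {K} 0<K refl p<δ q<K = subst (ℚ._< δ ℚ.* K) (sym (ℚ.∣p*q∣≡∣p∣*∣q∣ p q))
    (ℚ.≤-<-trans (ℚ.*-monoˡ-≤-nonNeg ℚ.∣ p ∣ ⦃ ℚ.nonNegative (ℚ.0≤∣p∣ p) ⦄ (ℚ.<⇒≤ q<K))
                 (ℚ.*-monoˡ-<-pos K ⦃ ℚ.positive 0<K ⦄ p<δ))

  -- A Cauchy sequence is eventually bounded, say by K, so the tolerance ε / K for `s` suffices.
  null-* : ∀ {s} x → IsNull s → IsNull (λ n → s n ℚ.* seq x n)
  null-* {s} x s→0 ε 0<ε = eventually-× {C = λ n → ℚ.∣ s n ℚ.* seq x n ∣ ℚ.< ε}
    (λ {n} → ∣*∣-small {s n} {seq x n} {δ} {K} {ε} 0<K δK≡ε) (s→0 δ 0<δ) bound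
    where
    K = proj₁ (seq-bounded x)
    0<K = proj₁ (proj₂ (seq-bounded x))
    bound = proj₂ (proj₂ (seq-bounded x))
    δ = proj₁ (quotient 0<ε 0<K)
    0<δ = proj₁ (proj₂ (quotient 0<ε 0<K))
    δK≡ε = proj₂ (proj₂ (quotient 0<ε 0<K))

  open RawRing ℝ-rawRing using (_+_; _*_; -_; 0#; 1#)

  ≡⇒≃ : ∀ {x y} → (∀ n → seq x n ≡ seq y n) → x ≃ y
  ≡⇒≃ {x} {y} eq = null-cong (λ n → sym (trans (cong (ℚ._- seq y n) (eq n)) (ℚ.+-inverseʳ (seq y n)))) null-0

  ≃-sym : ∀ {x y} → x ≃ y → y ≃ x
  ≃-sym {x} {y} eq = null-cong (λ n → reverse (seq x n) (seq y n)) (null-neg {λ n → seq x n ℚ.- seq y n} eq)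

  ≃-trans : ∀ {x y z} → x ≃ y → y ≃ z → x ≃ z
  ≃-trans {x} {y} {z} p q = null-cong (λ n → telescope (seq x n) (seq y n) (seq z n))
    (null-+ {λ n → seq x n ℚ.- seq y n} {λ n → seq y n ℚ.- seq z n} p q)

  -- The ring axioms hold term by term in ℚ; limits enter only in the equivalence and congruence
  -- laws. Implicit reals are spelled out because `_≃_` mentions their sequences alone and does not
  -- determine them.
  ℝ-ring : CommutativeRing 0ℓ 0ℓ
  ℝ-ring = record
    { Carrier = ℝ ; _≈_ = _≃_ ; _+_ = _+_ ; _*_ = _*_ ; -_ = -_ ; 0# = 0# ; 1# = 1#
    ; isCommutativeRing = record
      { isRing = record
        { +-isAbelianGroup = record
          { isGroup = record
            { isMonoid = record
              { isSemigroup = record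
                { isMagma = record
                  { isEquivalence = record
                    { refl = λ {x} → ≡⇒≃ {x} {x} λ n → refl
                    ; sym = λ {x} {y} → ≃-sym {x} {y}
                    ; trans = λ {x} {y} {z} → ≃-trans {x} {y} {z} }
                  ; ∙-cong = λ {x} {y} {u} {v} p q →
                      null-cong (λ n → +-difference (seq x n) (seq y n) (seq u n) (seq v n))
                        (null-+ {λ n → seq x n ℚ.- seq y n} {λ n → seq u n ℚ.- seq v n} p q) }
                ; assoc = λ x y z → ≡⇒≃ {x + y + z} {x + (y + z)} λ n → ℚ.+-assoc (seq x n) (seq y n) (seq z n) }
              ; identity = (λ x → ≡⇒≃ {0# + x} {x} λ n → ℚ.+-identityˡ (seq x n))
                         , (λ x → ≡⇒≃ {x + 0#} {x} λ n → ℚ.+-identityʳ (seq x n)) }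
            ; inverse = (λ x → ≡⇒≃ { - x + x} {0#} λ n → ℚ.+-inverseˡ (seq x n))
                      , (λ x → ≡⇒≃ {x + - x} {0#} λ n → ℚ.+-inverseʳ (seq x n))
            ; ⁻¹-cong = λ {x} {y} p → null-cong (λ n → neg-difference (seq x n) (seq y n))
                (null-neg {λ n → seq x n ℚ.- seq y n} p) }
          ; comm = λ x y → ≡⇒≃ {x + y} {y + x} λ n → ℚ.+-comm (seq x n) (seq y n) }
        ; *-cong = λ {x} {y} {u} {v} p q →
            null-cong (λ n → *-difference (seq x n) (seq y n) (seq u n) (seq v n))
              (null-+ {λ n → (seq x n ℚ.- seq y n) ℚ.* seq u n} {λ n → (seq u n ℚ.- seq v n) ℚ.* seq y n}
                (null-* {λ n → seq x n ℚ.- seq y n} u p) (null-* {λ n → seq u n ℚ.- seq v n} y q))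
        ; *-assoc = λ x y z → ≡⇒≃ {x * y * z} {x * (y * z)} λ n → ℚ.*-assoc (seq x n) (seq y n) (seq z n)
        ; *-identity = (λ x → ≡⇒≃ {1# * x} {x} λ n → ℚ.*-identityˡ (seq x n))
                     , (λ x → ≡⇒≃ {x * 1#} {x} λ n → ℚ.*-identityʳ (seq x n))
        ; distrib = (λ x y z → ≡⇒≃ {x * (y + z)} {x * y + x * z} λ n → ℚ.*-distribˡ-+ (seq x n) (seq y n) (seq z n))
                  , (λ x y z → ≡⇒≃ {(y + z) * x} {y * x + z * x} λ n → ℚ.*-distribʳ-+ (seq x n) (seq y n) (seq z n)) }
      ; *-comm = λ x y → ≡⇒≃ {x * y} {y * x} λ n → ℚ.*-comm (seq x n) (seq y n) } }

-- Sign rules for real numbers.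

module Signs where

  open import Algebra.Bundles using (CommutativeRing)
  open import Data.Nat.Base as ℕ using (ℕ; zero)
  import Data.Nat.Properties as ℕ
  open import Data.Rational.Base as ℚ using (ℚ; 0ℚ; 1ℚ; ½)
  import Data.Rational.Properties as ℚ
  open import Data.Product.Base using (_,_)
  open import Data.Maybe.Base using (Maybe; just; nothing)
  open import Data.Sign.Base as Sign using (Sign)
  open import Data.Sum.Base using (inj₁; inj₂)
  open import Level using (0ℓ)
  open import Relation.Nullary.Negation.Core using (¬_)
  open import Relation.Binary.PropositionalEquality as ≡ using (_≡_; refl; cong; subst; subst₂; sym; trans)
  import Algebra.Properties.Ring as RingProperties
  open import Defs
  open IntegerSolver
  open Reals

  module OrderIdentities (S : CommutativeRing 0ℓ 0ℓ) where
    open CommutativeRing S hiding (sym; trans; refl; zero)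
    open CommutativeRing S using () renaming (refl to ≈-refl)
    open IntegerCoefficients S

    cancel-difference : ∀ h x y → h + (x - y) + (y - x) ≈ h
    cancel-difference = solve 3 (λ h x y → h :+ (x :- y) :+ (y :- x) := h) ≈-refl

    add-difference : ∀ x y → x + (y - x) ≈ y
    add-difference = solve 2 (λ x y → x :+ (y :- x) := y) ≈-refl

    neg-*-neg : ∀ x y → - x * - y ≈ x * y
    neg-*-neg = solve 2 (λ x y → :- x :* :- y := x :* y) ≈-refl

  open OrderIdentities ℚ.+-*-commutativeRing using (cancel-difference; add-difference)
  open CommutativeRing ℝ-ring using (_+_; _*_; -_; 0#; 1#; -‿cong)
    renaming (refl to ≃-refl; sym to ≃-sym′)
  open RingProperties (CommutativeRing.ring ℝ-ring) using (-‿distribˡ-*; -‿distribʳ-*; -‿involutive; -‿+-comm)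

  private
    0+ : ∀ {p q} → 0ℚ ℚ.+ p ℚ.≤ q → p ℚ.≤ q
    0+ {p} = subst (ℚ._≤ _) (ℚ.+-identityˡ p)

    +0 : ∀ {p q} → p ℚ.≤ q → 0ℚ ℚ.+ p ℚ.≤ q
    +0 {p} = subst (ℚ._≤ _) (sym (ℚ.+-identityˡ p))

    p≤∣p∣ : ∀ p → p ℚ.≤ ℚ.∣ p ∣
    p≤∣p∣ p with ℚ.≤-total 0ℚ p
    ... | inj₁ 0≤p = ℚ.≤-reflexive (sym (ℚ.0≤p⇒∣p∣≡p 0≤p))
    ... | inj₂ p≤0 = ℚ.≤-trans p≤0 (ℚ.0≤∣p∣ p)

    close-bound : ∀ {ε p q} → ε ℚ.≤ p → ℚ.∣ p ℚ.- q ∣ ℚ.< ½ ℚ.* ε → ½ ℚ.* ε ℚ.≤ q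
    close-bound {ε} {p} {q} ε≤p p~q = subst₂ ℚ._≤_ (cancel-difference h p q) (add-difference p q)
      (ℚ.+-monoˡ-≤ (q ℚ.- p) (ℚ.≤-trans (ℚ.+-monoʳ-≤ h {p ℚ.- q} {h} (ℚ.≤-trans p-q≤ (ℚ.<⇒≤ p~q)))
        (ℚ.≤-trans (ℚ.≤-reflexive (½+½ ε)) ε≤p)))
      where
      h = ½ ℚ.* ε
      p-q≤ : p ℚ.- q ℚ.≤ ℚ.∣ p ℚ.- q ∣
      p-q≤ = p≤∣p∣ (p ℚ.- q)

    *-bound : ∀ {ε δ p q} → 0ℚ ℚ.< ε → 0ℚ ℚ.< δ → ε ℚ.≤ p → δ ℚ.≤ q → ε ℚ.* δ ℚ.≤ p ℚ.* q
    *-bound {ε} {δ} {p} {q} 0<ε 0<δ ε≤p δ≤q = ℚ.≤-trans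
      (ℚ.*-monoʳ-≤-nonNeg δ ⦃ ℚ.nonNegative (ℚ.<⇒≤ 0<δ) ⦄ ε≤p)
      (ℚ.*-monoˡ-≤-nonNeg p ⦃ ℚ.nonNegative (ℚ.≤-trans (ℚ.<⇒≤ 0<ε) ε≤p) ⦄ δ≤q)

  -- Half of the gap ε survives, since the two sequences are eventually closer than ε / 2.
  positive-cong : ∀ {x y} → x ≃ y → 0ℝ < x → 0ℝ < y
  positive-cong {x} {y} x≃y (ε , 0<ε , ev) = ½ ℚ.* ε , ½-positive 0<ε , eventually-×
    {C = λ n → 0ℚ ℚ.+ ½ ℚ.* ε ℚ.≤ seq y n}
    (λ {n} p q → +0 (close-bound {ε} {seq x n} {seq y n} (0+ p) q)) ev (x≃y (½ ℚ.* ε) (½-positive 0<ε))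

  positive-+ : ∀ {x y} → 0ℝ < x → 0ℝ < y → 0ℝ < x + y
  positive-+ {x} {y} (ε , 0<ε , ev) (δ , 0<δ , ev′) = ε ℚ.+ δ
    , ℚ.+-mono-< 0<ε 0<δ
    , eventually-× {C = λ n → 0ℚ ℚ.+ (ε ℚ.+ δ) ℚ.≤ seq x n ℚ.+ seq y n}
        (λ p q → +0 {ε ℚ.+ δ} (ℚ.+-mono-≤ (0+ {ε} p) (0+ {δ} q))) ev ev′

  positive-* : ∀ {x y} → 0ℝ < x → 0ℝ < y → 0ℝ < x * y
  positive-* {x} {y} (ε , 0<ε , ev) (δ , 0<δ , ev′) = ε ℚ.* δ , *-positive {ε} {δ} 0<ε 0<δ
    , eventually-× {C = λ n → 0ℚ ℚ.+ (ε ℚ.* δ) ℚ.≤ seq x n ℚ.* seq y n}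
        (λ {n} p q → +0 (*-bound {ε} {δ} {seq x n} {seq y n} 0<ε 0<δ (0+ p) (0+ q))) ev ev′

  negative⇒-positive : ∀ {x} → x < 0ℝ → 0ℝ < - x
  negative⇒-positive {x} (ε , 0<ε , ev) = ε , 0<ε , eventually-map
    {B = λ n → 0ℚ ℚ.+ ε ℚ.≤ ℚ.- seq x n}
    (λ {n} p → subst₂ ℚ._≤_ (cancelˡ (seq x n) ε) (ℚ.+-identityʳ _) (ℚ.+-monoʳ-≤ (ℚ.- seq x n) p)) ev
    where
    cancelˡ : ∀ p ε → ℚ.- p ℚ.+ (p ℚ.+ ε) ≡ 0ℚ ℚ.+ ε
    cancelˡ p ε = trans (sym (ℚ.+-assoc (ℚ.- p) p ε)) (cong (ℚ._+ ε) (ℚ.+-inverseˡ p))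

  -positive⇒negative : ∀ {x} → 0ℝ < - x → x < 0ℝ
  -positive⇒negative {x} (ε , 0<ε , ev) = ε , 0<ε , eventually-map
    {B = λ n → seq x n ℚ.+ ε ℚ.≤ 0ℚ}
    (λ {n} p → subst (seq x n ℚ.+ ε ℚ.≤_) (ℚ.+-inverseʳ (seq x n)) (ℚ.+-monoʳ-≤ (seq x n) (0+ p))) ev

  ¬0<0 : ¬ 0ℝ < 0ℝ
  ¬0<0 (ε , 0<ε , N , le) = ℚ.<-irrefl refl (ℚ.<-≤-trans 0<ε (0+ (le N ℕ.≤-refl)))

  HasSign-cong : ∀ {x y} s → x ≃ y → HasSign x (just s) → HasSign y (just s)
  HasSign-cong {x} {y} Sign.+ x≃y p = positive-cong {x} {y} x≃y p
  HasSign-cong {x} {y} Sign.- x≃y p =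
    -positive⇒negative {y} (positive-cong { - x} { - y} (-‿cong {x} {y} x≃y) (negative⇒-positive {x} p))

  HasSign-neg : ∀ {x} s → HasSign x (just s) → HasSign (- x) (just (Sign.opposite s))
  HasSign-neg {x} Sign.+ p = -positive⇒negative { - x} (positive-cong {x} { - - x} (≃-sym′ { - - x} {x} (-‿involutive x)) p)
  HasSign-neg {x} Sign.- p = negative⇒-positive {x} p

  HasSign-+ : ∀ {x y} s → HasSign x (just s) → HasSign y (just s) → HasSign (x + y) (just s)
  HasSign-+ {x} {y} Sign.+ p q = positive-+ {x} {y} p q
  HasSign-+ {x} {y} Sign.- p q = -positive⇒negative {x + y}
    (positive-cong { - x + - y} { - (x + y)} (-‿+-comm x y)
      (positive-+ { - x} { - y} (negative⇒-positive {x} p) (negative⇒-positive {y} q)))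

  HasSign-* : ∀ {x y} s t → HasSign x (just s) → HasSign y (just t) → HasSign (x * y) (just (s Sign.* t))
  HasSign-* {x} {y} Sign.+ Sign.+ p q = positive-* {x} {y} p q
  HasSign-* {x} {y} Sign.+ Sign.- p q = -positive⇒negative {x * y}
    (positive-cong {x * - y} { - (x * y)} (≃-sym′ { - (x * y)} {x * - y} (-‿distribʳ-* x y))
      (positive-* {x} { - y} p (negative⇒-positive {y} q)))
  HasSign-* {x} {y} Sign.- Sign.+ p q = -positive⇒negative {x * y}
    (positive-cong { - x * y} { - (x * y)} (≃-sym′ { - (x * y)} { - x * y} (-‿distribˡ-* x y))
      (positive-* { - x} {y} (negative⇒-positive {x} p) q))
  HasSign-* {x} {y} Sign.- Sign.- p q = positive-cong { - x * - y} {x * y}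
    (OrderIdentities.neg-*-neg ℝ-ring x y)
    (positive-* { - x} { - y} (negative⇒-positive {x} p) (negative⇒-positive {y} q))

  HasSign⇒#0 : ∀ {x} s → HasSign x (just s) → x # 0ℝ
  HasSign⇒#0 Sign.+ p = inj₂ p
  HasSign⇒#0 Sign.- p = inj₁ p

  #0⇒≄0 : ∀ {x} → x # 0ℝ → ¬ x ≃ 0ℝ
  #0⇒≄0 {x} (inj₁ p) x≃0 = ¬0<0 (positive-cong { - x} {0ℝ}
    (-‿cong {x} {0ℝ} x≃0) (negative⇒-positive {x} p))
  #0⇒≄0 {x} (inj₂ p) x≃0 = ¬0<0 (positive-cong {x} {0ℝ} x≃0 p)

  -- These values are the entries of the test matrix used for necessity.
  signValue : Maybe Sign → ℝ
  signValue nothing       = 0#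
  signValue (just Sign.+) = 1#
  signValue (just Sign.-) = - 1#

  signValue-HasSign : ∀ m → HasSign (signValue m) m
  signValue-HasSign nothing       = ≃-refl {0ℝ}
  signValue-HasSign (just Sign.+) = 1ℚ , ℚ.positive⁻¹ 1ℚ , 0 , λ _ _ → ℚ.≤-refl
  signValue-HasSign (just Sign.-) = HasSign-neg {1#} Sign.+ (signValue-HasSign (just Sign.+))

-- Polynomials modulo X², and the multiplicity of the root 0.

module Jets where

  open import Algebra.Bundles using (CommutativeRing; RawRing)
  import Algebra.Definitions.RawSemiring as RawSemiringOps
  open import Data.List.Base as List using (List; []; _∷_)
  open import Data.Nat.Base as ℕ using (zero; suc)
  open import Data.Product.Base using (_×_; _,_; proj₁; proj₂)
  open import Level using (0ℓ)
  open import Defs using (module Polynomial)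
  open IntegerSolver
  open Determinants
  open Reals

  -- R[ε] with ε² = 0; the pair (a , b) stands for a + b ε.
  module DualNumbers (R : CommutativeRing 0ℓ 0ℓ) where

    open CommutativeRing R hiding (zero)
    open IntegerCoefficients R

    dualRing : CommutativeRing 0ℓ 0ℓ
    dualRing = record
      { Carrier = Carrier × Carrier
      ; _≈_ = λ x y → proj₁ x ≈ proj₁ y × proj₂ x ≈ proj₂ y
      ; _+_ = λ x y → proj₁ x + proj₁ y , proj₂ x + proj₂ y
      ; _*_ = λ x y → proj₁ x * proj₁ y , proj₁ x * proj₂ y + proj₂ x * proj₁ y
      ; -_ = λ x → - proj₁ x , - proj₂ x
      ; 0# = 0# , 0#
      ; 1# = 1# , 0#
      ; isCommutativeRing = record
        { isRing = record
          { +-isAbelianGroup = record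
            { isGroup = record
              { isMonoid = record
                { isSemigroup = record
                  { isMagma = record
                    { isEquivalence = record
                      { refl = refl , refl
                      ; sym = λ (p , q) → sym p , sym q
                      ; trans = λ (p , q) (p′ , q′) → trans p p′ , trans q q′ }
                    ; ∙-cong = λ (p , q) (p′ , q′) → +-cong p p′ , +-cong q q′ }
                  ; assoc = λ x y z → +-assoc _ _ _ , +-assoc _ _ _ }
                ; identity = (λ x → +-identityˡ _ , +-identityˡ _) , (λ x → +-identityʳ _ , +-identityʳ _) }
              ; inverse = (λ x → -‿inverseˡ _ , -‿inverseˡ _) , (λ x → -‿inverseʳ _ , -‿inverseʳ _)
              ; ⁻¹-cong = λ (p , q) → -‿cong p , -‿cong q }
            ; comm = λ x y → +-comm _ _ , +-comm _ _ }
          ; *-cong = λ (p , q) (p′ , q′) → *-cong p p′ , +-cong (*-cong p q′) (*-cong q p′)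
          ; *-assoc = λ (a , a′) (b , b′) (c , c′) → *-assoc _ _ _ ,
              solve 6 (λ a a′ b b′ c c′ → a :* b :* c′ :+ (a :* b′ :+ a′ :* b) :* c :=
                a :* (b :* c′ :+ b′ :* c) :+ a′ :* (b :* c)) refl a a′ b b′ c c′
          ; *-identity =
              (λ (a , a′) → *-identityˡ _ , trans (+-cong (*-identityˡ _) (zeroˡ _)) (+-identityʳ _))
            , (λ (a , a′) → *-identityʳ _ , trans (+-cong (zeroʳ _) (*-identityʳ _)) (+-identityˡ _))
          ; distrib =
              (λ (a , a′) (b , b′) (c , c′) → distribˡ _ _ _ ,
                solve 6 (λ a a′ b b′ c c′ → a :* (b′ :+ c′) :+ a′ :* (b :+ c) :=
                  (a :* b′ :+ a′ :* b) :+ (a :* c′ :+ a′ :* c)) refl a a′ b b′ c c′)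
            , (λ (a , a′) (b , b′) (c , c′) → distribʳ _ _ _ ,
                solve 6 (λ a a′ b b′ c c′ → (b :+ c) :* a′ :+ (b′ :+ c′) :* a :=
                  (b :* a′ :+ b′ :* a) :+ (c :* a′ :+ c′ :* a)) refl a a′ b b′ c c′) }
        ; *-comm = λ (a , a′) (b , b′) → *-comm _ _ ,
            solve 4 (λ a a′ b b′ → a :* b′ :+ a′ :* b := b :* a′ :+ b′ :* a) refl a a′ b b′ } }

    module _ where
      open Polynomial rawRing using (Poly; coeff; add; mul; eval; X; const)
      private module P = Polynomial rawRing
      open RawRing P.rawRing using () renaming (_≈_ to _≈ᴾ_; _+_ to _+ᴾ_; _*_ to _*ᴾ_; -_ to -ᴾ_)
      open RawSemiringOps (RawRing.rawSemiring P.rawRing) using () renaming (_^_ to _^ᴾ_)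
      open Determinant dualRing using (IsHomomorphism)

      coeff-add : ∀ p q k → coeff (add p q) k ≈ coeff p k + coeff q k
      coeff-add []      q       k       = sym (+-identityˡ _)
      coeff-add (a ∷ p) []      k       = sym (+-identityʳ _)
      coeff-add (a ∷ p) (b ∷ q) zero    = refl
      coeff-add (a ∷ p) (b ∷ q) (suc k) = coeff-add p q k

      -0≈0 : - 0# ≈ 0#
      -0≈0 = trans (sym (+-identityˡ _)) (-‿inverseʳ 0#)

      coeff-neg : ∀ p k → coeff (List.map -_ p) k ≈ - coeff p k
      coeff-neg []      k       = sym -0≈0
      coeff-neg (a ∷ p) zero    = refl
      coeff-neg (a ∷ p) (suc k) = coeff-neg p k

      coeff-scale : ∀ a p k → coeff (List.map (a *_) p) k ≈ a * coeff p k
      coeff-scale a []      k       = sym (zeroʳ a)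
      coeff-scale a (b ∷ p) zero    = refl
      coeff-scale a (b ∷ p) (suc k) = coeff-scale a p k

      coeff-mul-0 : ∀ p q → coeff (mul p q) 0 ≈ coeff p 0 * coeff q 0
      coeff-mul-0 []      q = sym (zeroˡ _)
      coeff-mul-0 (a ∷ p) q = trans (coeff-add (List.map (a *_) q) _ 0)
        (trans (+-identityʳ _) (coeff-scale a q 0))

      coeff-mul-1 : ∀ p q → coeff (mul p q) 1 ≈ coeff p 0 * coeff q 1 + coeff p 1 * coeff q 0
      coeff-mul-1 []      q = sym (trans (+-cong (zeroˡ _) (zeroˡ _)) (+-identityʳ _))
      coeff-mul-1 (a ∷ p) q = trans (coeff-add (List.map (a *_) q) _ 1)
        (+-cong (coeff-scale a q 1) (coeff-mul-0 p q))

      -- p modulo X².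
      jet : Poly → Carrier × Carrier
      jet p = coeff p 0 , coeff p 1

      jet-homomorphism : IsHomomorphism P.rawRing jet
      jet-homomorphism = record
        { +-homo = λ p q → coeff-add p q 0 , coeff-add p q 1
        ; *-homo = λ p q → coeff-mul-0 p q , coeff-mul-1 p q
        ; -‿homo = λ p → coeff-neg p 0 , coeff-neg p 1
        ; 0#-homo = refl , refl
        ; 1#-homo = refl , refl }

      eval-0 : ∀ p → eval p 0# ≈ coeff p 0
      eval-0 []      = refl
      eval-0 (a ∷ p) = trans (+-congˡ (zeroˡ _)) (+-identityʳ a)

      -- The literal linear factor in `IsRootMultiplicity` at 0. Its constant coefficient is 0 + -
      -- 0, which is zero only up to the equality of the ring.
      X-0 : Poly
      X-0 = X +ᴾ (-ᴾ const 0#)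

      X-0-coeff-0 : coeff X-0 0 ≈ 0#
      X-0-coeff-0 = -‿inverseʳ 0#

      mul-const : ∀ a q k → coeff (mul (const a) q) k ≈ a * coeff q k
      mul-const a q k = trans (coeff-add (List.map (a *_) q) (0# ∷ []) k)
        (trans (+-cong (coeff-scale a q k) (coeff-0∷[] k)) (+-identityʳ _))
        where
        coeff-0∷[] : ∀ k → coeff (0# ∷ []) k ≈ 0#
        coeff-0∷[] zero    = refl
        coeff-0∷[] (suc k) = refl

      factor-0 : ∀ p → p ≈ᴾ (X-0 ^ᴾ 0) *ᴾ p
      factor-0 p k = sym (trans (mul-const 1# p k) (*-identityˡ _))

      factor-1 : ∀ p → coeff p 0 ≈ 0# → p ≈ᴾ (X-0 ^ᴾ 1) *ᴾ List.drop 1 p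
      factor-1 p p₀≈0 k = sym (trans (coeff-add (List.map (l₀ *_) q) _ k)
        (trans (+-congʳ (trans (coeff-scale l₀ q k) (trans (*-congʳ l₀≈0) (zeroˡ _))))
          (trans (+-identityˡ _) (tail p k p₀≈0))))
        where
        q = List.drop 1 p
        -- `l₀` and `l₁` are the two coefficients to which the power `X-0 ^ᴾ 1`, a product with the
        -- constant 1, computes.
        l₀ = (0# + - 0#) * 1# + 0#
        l₀≈0 : l₀ ≈ 0#
        l₀≈0 = trans (+-identityʳ _) (trans (*-identityʳ _) (-‿inverseʳ 0#))
        l₁ = 1# * 1# + 0#
        tail : ∀ p k → coeff p 0 ≈ 0# → coeff (0# ∷ mul (const l₁) (List.drop 1 p)) k ≈ coeff p k
        tail p       zero    p₀≈0 = sym p₀≈0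
        tail []      (suc k) _    = trans (mul-const l₁ [] k) (zeroʳ _)
        tail (a ∷ p) (suc k) _    = trans (mul-const l₁ p k)
          (trans (*-congʳ (trans (+-identityʳ _) (*-identityʳ 1#))) (*-identityˡ _))

      -- This lemma and the two `multiplicity-` lemmas below serve necessity, where the cofactor is
      -- whatever the given factorisation provides. They extract what the exponent says about the
      -- first two coefficients.
      multiplicity-0-coeff : ∀ p q → p ≈ᴾ (X-0 ^ᴾ 0) *ᴾ q → coeff p 0 ≈ coeff q 0
      multiplicity-0-coeff p q eq = trans (eq 0) (sym (factor-0 q 0))

      power-coeff-0 : ∀ m → coeff (X-0 ^ᴾ suc m) 0 ≈ 0#
      power-coeff-0 m = trans (coeff-mul-0 X-0 (X-0 ^ᴾ m)) (trans (*-congʳ X-0-coeff-0) (zeroˡ _))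

      multiplicity-suc-coeff : ∀ m p q → p ≈ᴾ (X-0 ^ᴾ suc m) *ᴾ q → coeff p 0 ≈ 0#
      multiplicity-suc-coeff m p q eq = trans (eq 0) (trans (coeff-mul-0 (X-0 ^ᴾ suc m) q)
        (trans (*-congʳ (power-coeff-0 m)) (zeroˡ _)))

      multiplicity-2+-coeff : ∀ m p q → p ≈ᴾ (X-0 ^ᴾ suc (suc m)) *ᴾ q → coeff p 1 ≈ 0#
      multiplicity-2+-coeff m p q eq = trans (eq 1) (trans (coeff-mul-1 (X-0 ^ᴾ suc (suc m)) q)
        (trans (+-cong (trans (*-congʳ (power-coeff-0 (suc m))) (zeroˡ _))
                       (trans (*-congʳ power-coeff-1) (zeroˡ _))) (+-identityʳ _)))
        where
        power-coeff-1 : coeff (X-0 ^ᴾ suc (suc m)) 1 ≈ 0#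
        power-coeff-1 = trans (coeff-mul-1 X-0 (X-0 ^ᴾ suc m))
          (trans (+-cong (trans (*-congʳ X-0-coeff-0) (zeroˡ _))
                         (trans (*-congˡ (power-coeff-0 m)) (zeroʳ _))) (+-identityʳ _))

-- Iterates of the shift modulo n.

module CyclicShift where

  open import Data.Fin.Base using (Fin; zero; suc; toℕ)
  import Data.Fin.Properties as Fin
  open import Data.Nat.Base as ℕ using (ℕ; zero; suc; _+_; _*_; _∸_; _<_)
  open import Data.Nat.DivMod using (_%_; _/_; m≡m%n+[m/n]*n; m<n⇒m%n≡m; %-distribˡ-+; [m+n]%n≡m%n; m%n<n; m%n%n≡m%n)
  open import Data.Nat.Divisibility using (_∣_; divides; ∣⇒≤)
  import Data.Nat.Properties as ℕ
  open import Data.Product.Base using (_×_; _,_; ∃-syntax)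
  open import Relation.Binary.PropositionalEquality
  open import Defs using (next)

  next^ : ∀ {n} → ℕ → Fin n → Fin n
  next^ zero    u = u
  next^ (suc i) u = next (next^ i u)

  next^-+ : ∀ {n} i j (u : Fin n) → next^ (i + j) u ≡ next^ i (next^ j u)
  next^-+ zero    j u = refl
  next^-+ (suc i) j u = cong next (next^-+ i j u)

  toℕ-next^ : ∀ {m} i (u : Fin (suc m)) → toℕ (next^ i u) ≡ (toℕ u + i) % suc m
  toℕ-next^ {m} zero    u = sym (trans (cong (_% suc m) (ℕ.+-identityʳ (toℕ u))) (m<n⇒m%n≡m (Fin.toℕ<n u)))
  toℕ-next^ {m} (suc i) u = begin
    toℕ (next (next^ i u))                     ≡⟨ Fin.toℕ-fromℕ< _ ⟩
    suc (toℕ (next^ i u)) % suc m              ≡⟨ cong (λ k → suc k % suc m) (toℕ-next^ i u) ⟩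
    (1 + (toℕ u + i) % suc m) % suc m          ≡⟨ %-distribˡ-+ 1 _ (suc m) ⟩
    (1 % suc m + (toℕ u + i) % suc m % suc m) % suc m
      ≡⟨ cong (λ k → (1 % suc m + k) % suc m) (m%n%n≡m%n (toℕ u + i) (suc m)) ⟩
    (1 % suc m + (toℕ u + i) % suc m) % suc m  ≡⟨ %-distribˡ-+ 1 (toℕ u + i) (suc m) ⟨
    suc (toℕ u + i) % suc m                    ≡⟨ cong (_% suc m) (ℕ.+-suc (toℕ u) i) ⟨
    (toℕ u + suc i) % suc m                    ∎
    where open ≡-Reasoning

  next^-n : ∀ {n} (u : Fin n) → next^ n u ≡ u
  next^-n {suc m} u = Fin.toℕ-injective (trans (toℕ-next^ (suc m) u)
    (trans ([m+n]%n≡m%n (toℕ u) (suc m)) (m<n⇒m%n≡m (Fin.toℕ<n u))))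

  next-injective : ∀ {n} {u v : Fin n} → next u ≡ next v → u ≡ v
  next-injective {suc m} {u} {v} eq = trans (sym (undo u)) (trans (cong (next^ m) eq) (undo v))
    where
    undo : ∀ u → next^ m (next u) ≡ u
    undo u = trans (sym (next^-+ m 1 u)) (trans (cong (λ k → next^ k u) (ℕ.+-comm m 1)) (next^-n u))

  next^-fixed⇒∣ : ∀ {n} d (u : Fin n) → next^ d u ≡ u → n ∣ d
  next^-fixed⇒∣ {suc m} d u eq = divides ((toℕ u + d) / suc m) (ℕ.+-cancelˡ-≡ (toℕ u) d _ (begin
    toℕ u + d                                            ≡⟨ m≡m%n+[m/n]*n (toℕ u + d) (suc m) ⟩
    (toℕ u + d) % suc m + (toℕ u + d) / suc m * suc m    ≡⟨ cong (_+ (toℕ u + d) / suc m * suc m) (trans (sym (toℕ-next^ d u)) (cong toℕ eq)) ⟩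
    toℕ u + (toℕ u + d) / suc m * suc m                  ∎))
    where open ≡-Reasoning

  -- The difference j - i would be a positive multiple of n smaller than n. Bounding the difference
  -- instead of the indices allows positions beyond n.
  next^-distinct : ∀ {n} {i j} (u : Fin n) → i < j → j < n + i → next^ i u ≢ next^ j u
  next^-distinct {n} {i} {j} u i<j j<n+i eq = ℕ.<⇒≱ d<n (∣⇒≤ ⦃ ℕ.>-nonZero (ℕ.m<n⇒0<n∸m i<j) ⦄ n∣d)
    where
    d = j ∸ i
    n∣d : n ∣ d
    n∣d = next^-fixed⇒∣ d (next^ i u) (trans (sym (next^-+ d i u))
      (trans (cong (λ k → next^ k u) (ℕ.m∸n+n≡m (ℕ.<⇒≤ i<j))) (sym eq)))
    d<n : d < n
    d<n = ℕ.+-cancelʳ-< i d n (subst (_< n + i) (sym (ℕ.m∸n+n≡m (ℕ.<⇒≤ i<j))) j<n+i)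

  next^-transitive : ∀ {n} (u v : Fin n) → ∃[ i ] i < n × next^ i u ≡ v
  next^-transitive {suc m} u v = i , m%n<n (toℕ v + (n ∸ toℕ u)) n , Fin.toℕ-injective (begin
    toℕ (next^ i u)                              ≡⟨ toℕ-next^ i u ⟩
    (toℕ u + i) % n                              ≡⟨ cong (λ k → (k + i) % n) (m<n⇒m%n≡m (Fin.toℕ<n u)) ⟨
    (toℕ u % n + (toℕ v + (n ∸ toℕ u)) % n) % n  ≡⟨ %-distribˡ-+ (toℕ u) _ n ⟨
    (toℕ u + (toℕ v + (n ∸ toℕ u))) % n          ≡⟨ cong (_% n) shuffle ⟩
    (toℕ v + n) % n                              ≡⟨ [m+n]%n≡m%n (toℕ v) n ⟩
    toℕ v % n                                    ≡⟨ m<n⇒m%n≡m (Fin.toℕ<n v) ⟩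
    toℕ v                                        ∎)
    where
    open ≡-Reasoning
    n = suc m
    -- This is v - u modulo n, with n - u standing for -u.
    i = (toℕ v + (n ∸ toℕ u)) % n
    shuffle : toℕ u + (toℕ v + (n ∸ toℕ u)) ≡ toℕ v + n
    shuffle = trans (sym (ℕ.+-assoc (toℕ u) (toℕ v) _)) (trans (cong (_+ (n ∸ toℕ u)) (ℕ.+-comm (toℕ u) (toℕ v)))
      (trans (ℕ.+-assoc (toℕ v) (toℕ u) _) (cong (toℕ v +_) (ℕ.m+[n∸m]≡n (ℕ.<⇒≤ (Fin.toℕ<n u))))))

-- Walks, simple cycles and composite cycles of a cycle pattern.

module CycleGraphs where

  import Algebra.Definitions.RawMonoid as RawMonoidOps
  open import Data.Empty using (⊥; ⊥-elim)
  open import Data.Fin.Base using (Fin; zero; suc; toℕ; punchIn)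
  import Data.Fin.Properties as Fin
  open import Data.Fin.Permutation using (_⟨$⟩ʳ_; _⟨$⟩ˡ_; inverseˡ; inverseʳ)
  open import Data.List.Base as List using (List; []; _∷_; tabulate; foldr)
  open import Data.List.Membership.Propositional using (_∈_)
  open import Data.List.Membership.Propositional.Properties using (∈-map⁺; ∈-tabulate⁺)
  open import Data.List.Membership.Propositional.Properties.WithK using (unique∧set⇒bag)
  import Data.List.NonEmpty.Base as List⁺
  open import Data.List.Relation.Binary.BagAndSetEquality using (∼bag⇒↭)
  open import Data.List.Relation.Binary.Permutation.Propositional as Perm using (_↭_)
  open import Data.List.Relation.Unary.All as All using (All; []; _∷_)
  import Data.List.Relation.Unary.All.Properties as All
  open import Data.List.Relation.Unary.AllPairs using (AllPairs; []; _∷_)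
  open import Data.List.Relation.Unary.Any using (here; there)
  open import Data.List.Relation.Unary.Unique.Propositional using (Unique)
  import Data.List.Relation.Unary.Unique.Propositional.Properties as Unique
  open import Data.Maybe.Base using (Maybe; just; nothing)
  open import Data.Maybe.Properties using (just-injective)
  open import Data.Nat.Base as ℕ using (ℕ; zero; suc; _+_; _*_; _≤_; _<_; s≤s; z≤n)
  open import Data.Nat.DivMod using (m<n⇒m%n≡m)
  open import Data.Nat.Divisibility using (∣⇒≤)
  open import Data.Nat.ListAction using (sum)
  import Data.Nat.Properties as ℕ
  open import Data.Product.Base using (_×_; _,_; ∃-syntax; proj₁; proj₂)
  open import Data.Sign.Base as Sign using (Sign; opposite)
  import Data.Sign.Properties as Sign
  open import Data.Sum.Base using (_⊎_; inj₁; inj₂)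
  open import Function.Base using (_∘_; id)
  open import Function.Bundles using (mk⇔; Equivalence)
  open import Relation.Binary.PropositionalEquality
  open import Defs hiding (_<_)
  open SparseDeterminants
  open CyclicShift

  open RawMonoidOps Sign.*-1-rawMonoid using () renaming (sum to ∏; _×_ to infixl 8 _times_)

  alternating : ℕ → Sign
  alternating k = k times Sign.-

  alternating-even : ∀ k → alternating (k * 2) ≡ Sign.+
  alternating-even zero    = refl
  alternating-even (suc k) = trans (Sign.opposite-involutive _) (alternating-even k)

  alternating-+ : ∀ j k → alternating (j + k) ≡ alternating j Sign.* alternating k
  alternating-+ zero    k = refl
  alternating-+ (suc j) k = trans (cong opposite (alternating-+ j k)) (sym (Sign.*-assoc Sign.- (alternating j) (alternating k)))

  -- Indexed by an interval of positions, in step with `segment` and `superdiagonal`, so that it can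
  -- follow the weights along a walk.
  product : (ℕ → Sign) → ℕ → ℕ → Sign
  product f a zero    = Sign.+
  product f a (suc m) = f a Sign.* product f (suc a) m

  product-∷ʳ : ∀ f a m → product f a (suc m) ≡ product f a m Sign.* f (a + m)
  product-∷ʳ f a zero    = trans (Sign.*-identityʳ (f a)) (cong f (sym (ℕ.+-identityʳ a)))
  product-∷ʳ f a (suc m) = trans (cong (f a Sign.*_) (trans (product-∷ʳ f (suc a) m)
      (cong (λ k → product f (suc a) m Sign.* f k) (sym (ℕ.+-suc a m)))))
    (sym (Sign.*-assoc (f a) _ _))

  product-cong : ∀ {f g} a m → (∀ i → f i ≡ g i) → product f a m ≡ product g a m
  product-cong a zero    eq = refl
  product-cong a (suc m) eq = cong₂ Sign._*_ (eq a) (product-cong (suc a) m eq)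

  product-suc : ∀ f a m → product (f ∘ suc) a m ≡ product f (suc a) m
  product-suc f a zero    = refl
  product-suc f a (suc m) = cong (f (suc a) Sign.*_) (product-suc f (suc a) m)

  ∏≡product : ∀ {K} (f : Fin K → Sign) g a → (∀ j → f j ≡ g (a + toℕ j)) → ∏ f ≡ product g a K
  ∏≡product {zero}  f g a eq = refl
  ∏≡product {suc K} f g a eq = cong₂ Sign._*_ (trans (eq zero) (cong g (ℕ.+-identityʳ a)))
    (∏≡product (f ∘ suc) g (suc a) λ j → trans (eq (suc j)) (cong g (ℕ.+-suc a (toℕ j))))

  tabulate-punchIn : ∀ {A : Set} {n} (f : Fin (suc n) → A) j →
    tabulate f ↭ f j ∷ tabulate (f ∘ punchIn j)
  tabulate-punchIn             f zero    = Perm.refl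
  tabulate-punchIn {n = suc n} f (suc j) =
    Perm.trans (Perm.prep (f zero) (tabulate-punchIn (f ∘ suc) j)) (Perm.swap _ _ Perm.refl)

  next^-suc : ∀ {n} i (u : Fin n) → next^ i (next u) ≡ next^ (suc i) u
  next^-suc zero    u = refl
  next^-suc (suc i) u = cong next (next^-suc i u)

  next^-toℕ : ∀ {n} (j : Fin (suc n)) → next^ (toℕ j) zero ≡ j
  next^-toℕ j = Fin.toℕ-injective (trans (toℕ-next^ (toℕ j) zero) (m<n⇒m%n≡m (Fin.toℕ<n j)))

  just? : ∀ {A : Set} (m : Maybe A) → m ≢ nothing → ∃[ a ] m ≡ just a
  just? nothing  m≢ = ⊥-elim (m≢ refl)
  just? (just a) _  = a , refl

  module CyclePattern {n} (P : SignPattern n) (P-sym : Symmetric P) (P-diag : ∀ i → P i i ≡ nothing)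
    (iso : IsCycleGraph (UnderlyingGraph P)) where

    private
      σ : Fin n → Fin n
      σ u = proj₁ iso ⟨$⟩ʳ u
      σ⁻¹ : Fin n → Fin n
      σ⁻¹ u = proj₁ iso ⟨$⟩ˡ u
      σσ⁻¹ : ∀ v → σ (σ⁻¹ v) ≡ v
      σσ⁻¹ v = inverseʳ (proj₁ iso)
      σ-injective : ∀ {u v} → σ u ≡ σ v → u ≡ v
      σ-injective {u} {v} eq = trans (sym (inverseˡ (proj₁ iso))) (trans (cong σ⁻¹ eq) (inverseˡ (proj₁ iso)))

    private
      edge : ∀ u → ∃[ s ] P (σ u) (σ (next u)) ≡ just s
      edge u = just? _ (Equivalence.from (proj₂ iso u (next u)) (inj₁ refl))

    edgeSign : Fin n → Sign
    edgeSign u = proj₁ (edge u)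

    adjacent : ∀ {u v s} → P (σ u) (σ v) ≡ just s → v ≡ next u ⊎ u ≡ next v
    adjacent {u} {v} eq = Equivalence.to (proj₂ iso u v) λ eq′ → case-nothing (trans (sym eq) eq′)
      where
      case-nothing : ∀ {s : Sign} → just s ≢ nothing
      case-nothing ()

    -- The position ranges over all natural numbers, with period n, so that the closing edge is
    -- simply the step from n - 1 to n.
    walk : Fin n → ℕ → Fin n
    walk t i = σ (next^ i t)

    walkSign : Fin n → ℕ → Sign
    walkSign t i = edgeSign (next^ i t)

    walk-edge : ∀ t i → P (walk t i) (walk t (suc i)) ≡ just (walkSign t i)
    walk-edge t i = proj₂ (edge (next^ i t))

    walk-distinct : ∀ t {i j} → i < j → j < n + i → walk t i ≢ walk t j
    walk-distinct t i<j j< eq = next^-distinct t i<j j< (σ-injective eq)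

    walk-closed : ∀ t → walk t n ≡ walk t 0
    walk-closed t = cong σ (next^-n t)

    walk-start : ∀ j → ∃[ t ] walk t 0 ≡ j
    walk-start j = σ⁻¹ j , σσ⁻¹ j

    -- The two bounds keep `j` away from the two neighbours of `i`, at the positions i + 1 and i + n
    -- - 1.
    nonadjacent : ∀ t {i j} → suc i < j → suc j < n + i → P (walk t i) (walk t j) ≡ nothing
    nonadjacent t {i} {j} i+1<j j+1< with P (walk t i) (walk t j) in eq
    ... | nothing = refl
    ... | just s with adjacent eq
    ...   | inj₁ j≡i+1 = ⊥-elim (next^-distinct t i+1<j
              (ℕ.<-≤-trans (ℕ.≤-<-trans (ℕ.n≤1+n j) j+1<) (ℕ.+-monoʳ-≤ n (ℕ.n≤1+n i))) (sym j≡i+1))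
    ...   | inj₂ i≡j+1 = ⊥-elim (next^-distinct t (ℕ.≤-trans (ℕ.<⇒≤ i+1<j) (ℕ.n≤1+n j)) j+1< i≡j+1)

    private
      walk-unique : ∀ t a k → a + k ≤ n → Unique (List.map (walk t) (segment a k))
      walk-unique t a zero    _    = []
      walk-unique t a (suc k) a+k≤ = All.map⁺ (All-segment (suc a) k λ a<i i< → walk-distinct t a<i
          (ℕ.<-≤-trans i< (ℕ.≤-trans bound (ℕ.m≤m+n n a))))
        ∷ walk-unique t (suc a) k bound
        where
        bound : suc a + k ≤ n
        bound = subst (_≤ n) (ℕ.+-suc a k) a+k≤

      ∈-segment : ∀ a m {i} → i < m → a + i ∈ segment a m
      ∈-segment a (suc m) {zero}  _         = here (ℕ.+-identityʳ a)
      ∈-segment a (suc m) {suc i} (s≤s i<m) = there (subst (_∈ segment (suc a) m) (sym (ℕ.+-suc a i)) (∈-segment (suc a) m i<m))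

    -- This carries the renumbering of the determinants. Each side contains every vertex exactly
    -- once, so the two agree as bags.
    walk-↭ : ∀ t → tabulate id ↭ List.map (walk t) (segment 0 n)
    walk-↭ t = ∼bag⇒↭ (unique∧set⇒bag (Unique.tabulate⁺ id) (walk-unique t 0 n ℕ.≤-refl)
      (mk⇔ (λ _ → covers _) (λ _ → ∈-tabulate⁺ _)))
      where
      covers : ∀ v → v ∈ List.map (walk t) (segment 0 n)
      covers v = subst (_∈ _) (trans (cong σ (proj₂ (proj₂ reach))) (σσ⁻¹ v))
        (∈-map⁺ (walk t) (∈-segment 0 n (proj₁ (proj₂ reach))))
        where reach = next^-transitive t (σ⁻¹ v)

    -- The product of the labels over all edges of the cycle, that is, the sign of e f for the two
    -- perfect matchings when n is even.
    totalSign : Fin n → Sign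
    totalSign t = product (walkSign t) 0 n

    private
      -- Starting one step later moves the first factor to the end, where periodicity makes it the
      -- label at position n.
      totalSign-next : ∀ t → totalSign (next t) ≡ totalSign t
      totalSign-next t = Sign.*-cancelˡ-≡ (f 0) _ _ (begin
        f 0 Sign.* product (walkSign (next t)) 0 n
          ≡⟨ cong (f 0 Sign.*_) (trans (product-cong 0 n λ i → cong edgeSign (next^-suc i t)) (product-suc f 0 n)) ⟩
        f 0 Sign.* product f 1 n  ≡⟨ product-∷ʳ f 0 n ⟩
        product f 0 n Sign.* f n  ≡⟨ cong (λ u → product f 0 n Sign.* edgeSign u) (next^-n t) ⟩
        product f 0 n Sign.* f 0  ≡⟨ Sign.*-comm (product f 0 n) (f 0) ⟩
        f 0 Sign.* product f 0 n  ∎)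
        where
        open ≡-Reasoning
        f = walkSign t

      totalSign-next^ : ∀ i t → totalSign (next^ i t) ≡ totalSign t
      totalSign-next^ zero    t = refl
      totalSign-next^ (suc i) t = trans (totalSign-next (next^ i t)) (totalSign-next^ i t)

    totalSign-constant : ∀ t u → totalSign t ≡ totalSign u
    totalSign-constant t u with next^-transitive u t
    ... | i , _ , eq = trans (cong totalSign (sym eq)) (totalSign-next^ i u)

    -- A simple cycle of length at least 3 cannot turn back, so its first step fixes the direction
    -- of all the others. It then closes up only after a multiple of n steps, and by distinctness of
    -- its vertices it has at most n of them.
    module _ (γ : SimpleCycle P) (3≤ : 3 ≤ SimpleCycle.length γ) where
      open SimpleCycle γ renaming (edge to γ-edge)
      private
        K = SimpleCycle.length γ

        r : ℕ → Fin K
        r i = next^ i zero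

        -- The cycle γ pulled back along σ to the standard cycle on `Fin n`, with its index extended
        -- periodically.
        U : ℕ → Fin n
        U i = σ⁻¹ (vertex (r i))

        U-edge : ∀ i → P (σ (U i)) (σ (U (suc i))) ≡ just (label (r i))
        U-edge i = trans (cong₂ P (σσ⁻¹ _) (σσ⁻¹ _)) (γ-edge (r i))

        -- The bound on the length enters here: in a 2-cycle the index i + 2 is i again.
        U-no-return : ∀ i → U i ≢ U (suc (suc i))
        U-no-return i eq = next^-distinct {i = i} {suc (suc i)} zero (ℕ.n≤1+n _) (ℕ.+-monoˡ-≤ i 3≤)
          (distinct (trans (sym (σσ⁻¹ _)) (trans (cong σ eq) (σσ⁻¹ _))))

        U-closed : U K ≡ U 0
        U-closed = cong (λ u → σ⁻¹ (vertex u)) (next^-n zero)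

        closed⇒length : next^ K (U 0) ≡ U 0 → K ≡ n
        closed⇒length eq = ℕ.≤-antisym (Fin.injective⇒≤ distinct) (∣⇒≤ (next^-fixed⇒∣ K (U 0) eq))

        ∏-label : ∏ label ≡ product (λ i → label (r i)) 0 K
        ∏-label = ∏≡product label (λ i → label (r i)) 0 λ j → cong label (sym (next^-toℕ j))

        Conclusion : Set
        Conclusion = K ≡ n × ∏ label ≡ totalSign (U 0)

        forward : U 1 ≡ next (U 0) → Conclusion
        forward start = K≡n , trans ∏-label (trans (product-cong 0 K label≡)
          (cong (product (walkSign (U 0)) 0) K≡n))
          where
          steps : ∀ i → U (suc i) ≡ next (U i)
          steps zero    = start
          steps (suc i) with adjacent (U-edge (suc i))
          ... | inj₁ eq = eq
          ... | inj₂ eq = ⊥-elim (U-no-return i (next-injective (trans (sym (steps i)) eq)))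

          position : ∀ i → U i ≡ next^ i (U 0)
          position zero    = refl
          position (suc i) = trans (steps i) (cong next (position i))

          K≡n : K ≡ n
          K≡n = closed⇒length (trans (sym (position K)) U-closed)

          label≡ : ∀ i → label (r i) ≡ walkSign (U 0) i
          label≡ i = just-injective (trans (sym (U-edge i))
            (trans (cong₂ (λ u v → P (σ u) (σ v)) (position i) (position (suc i))) (walk-edge (U 0) i)))

        backward : U 0 ≡ next (U 1) → Conclusion
        backward start = K≡n , trans ∏-label (trans (product-reverse K)
          (trans (cong (product (walkSign (U K)) 0) K≡n) (cong totalSign U-closed)))
          where
          steps : ∀ i → U i ≡ next (U (suc i))
          steps zero    = start
          steps (suc i) with adjacent (U-edge (suc i))
          ... | inj₁ eq = ⊥-elim (U-no-return i (trans (steps i) (sym eq)))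
          ... | inj₂ eq = eq

          position : ∀ i → U 0 ≡ next^ i (U i)
          position zero    = refl
          position (suc i) = trans (position i) (trans (cong (next^ i) (steps i)) (next^-suc i (U (suc i))))

          K≡n : K ≡ n
          K≡n = closed⇒length (trans (cong (next^ K) (sym U-closed)) (sym (position K)))

          label≡ : ∀ i → label (r i) ≡ edgeSign (U (suc i))
          label≡ i = just-injective (trans (sym (U-edge i)) (trans (P-sym _ _)
            (trans (cong (λ u → P (σ (U (suc i))) (σ u)) (steps i)) (proj₂ (edge (U (suc i)))))))

          -- Against the direction of `next`, the i-th label belongs to the edge that leaves U (i +
          -- 1) in forward direction. The product is therefore read as a forward walk from the last
          -- vertex U m.
          product-reverse : ∀ m → product (λ i → label (r i)) 0 m ≡ product (walkSign (U m)) 0 m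
          product-reverse zero    = refl
          product-reverse (suc m) = begin
            product (λ i → label (r i)) 0 (suc m)          ≡⟨ product-∷ʳ _ 0 m ⟩
            product (λ i → label (r i)) 0 m Sign.* label (r m)
              ≡⟨ cong₂ Sign._*_ (product-reverse m) (label≡ m) ⟩
            product (walkSign (U m)) 0 m Sign.* edgeSign u  ≡⟨ Sign.*-comm (product (walkSign (U m)) 0 m) _ ⟩
            edgeSign u Sign.* product (walkSign (U m)) 0 m
              ≡⟨ cong (edgeSign u Sign.*_) (trans
                   (product-cong 0 m λ i → cong edgeSign (trans (cong (next^ i) (steps m)) (next^-suc i u)))
                   (product-suc (walkSign u) 0 m)) ⟩
            product (walkSign u) 0 (suc m)                 ∎
            where
            open ≡-Reasoning
            u = U (suc m)

      long-cycle : SimpleCycle.length γ ≡ n × ∃[ t ] ∏ label ≡ totalSign t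
      long-cycle with adjacent (U-edge 0)
      ... | inj₁ eq = proj₁ (forward eq) , U 0 , proj₂ (forward eq)
      ... | inj₂ eq = proj₁ (backward eq) , U 0 , proj₂ (backward eq)

    -- By hypothesis the whole cycle has the sign of q disjoint 2-cycles, so every simple cycle of
    -- length 2h has sign (-1)^h. Both the length and this sign are compatible with composition, and
    -- `composite-sgn` follows by adding up the h.
    sgn-alternates : ∀ q → n ≡ q * 2 → ∀ t → opposite (totalSign t) ≡ alternating q → (γ : SimpleCycle P) →
      ∃[ h ] SimpleCycle.length γ ≡ h * 2 × SimpleCycle.sgn γ ≡ alternating h
    sgn-alternates q n≡ t eq γ = go (SimpleCycle.length-1 γ) refl
      where
      open SimpleCycle γ renaming (edge to γ-edge)

      loop : ∀ {v w s} → v ≡ w → P v w ≡ just s → ⊥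
      loop {v} refl e with () ← trans (sym e) (P-diag v)

      go : ∀ l → length-1 ≡ l → ∃[ h ] SimpleCycle.length γ ≡ h * 2 × sgn ≡ alternating h
      go (suc (suc l)) refl = q , trans (proj₁ long) n≡ , (begin
          alternating length-1 Sign.* ∏ label  ≡⟨ cong₂ Sign._*_ odd (trans (proj₂ (proj₂ long)) (totalSign-constant _ t)) ⟩
          Sign.- Sign.* totalSign t            ≡⟨ eq ⟩
          alternating q                        ∎)
        where
        open ≡-Reasoning
        long = long-cycle γ (s≤s (s≤s (s≤s z≤n)))
        odd : alternating length-1 ≡ Sign.-
        odd = Sign.opposite-injective (trans (cong alternating (trans (proj₁ long) n≡)) (alternating-even q))
      go (suc zero) refl = 1 , refl , cong (λ s → Sign.- Sign.* (label zero Sign.* (s Sign.* Sign.+))) label-eq′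
          ∙ cong opposite (trans (cong (label zero Sign.*_) (Sign.*-identityʳ (label zero))) (Sign.s*s≡+ (label zero)))
        where
        _∙_ = trans
        label-eq′ : label (suc zero) ≡ label zero
        label-eq′ = just-injective (trans (sym (γ-edge (suc zero))) (trans (P-sym _ _) (γ-edge zero)))
      go zero refl = ⊥-elim (loop refl (γ-edge zero))

    composite-sgn : ∀ q → n ≡ q * 2 → ∀ t → opposite (totalSign t) ≡ alternating q →
      ∀ (Γ : CompositeCycle P) → CompositeCycle.length Γ ≡ n → CompositeCycle.sgn Γ ≡ alternating q
    composite-sgn q n≡ t eq Γ len with go (List⁺.toList (CompositeCycle.factors Γ))
      where
      go : (γs : List (SimpleCycle P)) → ∃[ h ] sum (List.map SimpleCycle.length γs) ≡ h * 2
        × foldr Sign._*_ Sign.+ (List.map SimpleCycle.sgn γs) ≡ alternating h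
      go []       = 0 , refl , refl
      go (γ ∷ γs) with sgn-alternates q n≡ t eq γ | go γs
      ... | h , len , sgn | h′ , len′ , sgn′ = h + h′
        , trans (cong₂ _+_ len len′) (sym (ℕ.*-distribʳ-+ 2 h h′))
        , trans (cong₂ Sign._*_ sgn sgn′) (sym (alternating-+ h h′))
    ... | h , len′ , sgn = trans sgn (cong alternating (ℕ.*-cancelʳ-≡ h q 2 (trans (sym len′) (trans len n≡))))

    private
      singleton : SimpleCycle P → CompositeCycle P
      singleton γ = record { factors = γ List⁺.∷ [] ; disjoint = [] ∷ [] }

    -- Two composite cycles of length n are compared: the Hamiltonian cycle, whose sign is opposite
    -- to `totalSign`, and the perfect matching of the positions 2i and 2i + 1. Writing n as 2 (q +
    -- 1) makes the list of pairs nonempty.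
    sameSign⇒ : ∀ q → n ≡ suc q * 2 → SameSignCompositeCycles P n →
      ∀ t → opposite (totalSign t) ≡ alternating (suc q)
    sameSign⇒ q refl same t = begin
      opposite (totalSign t)           ≡⟨ cong opposite (totalSign-constant t zero) ⟩
      opposite (totalSign zero)        ≡⟨ cong₂ Sign._*_ odd ∏-edgeSign ⟨
      SimpleCycle.sgn hamiltonian      ≡⟨ Sign.*-identityʳ _ ⟨
      CompositeCycle.sgn (singleton hamiltonian)
        ≡⟨ same (singleton hamiltonian) matching (ℕ.+-identityʳ n) (proj₁ (matching-data 0 (suc q))) ⟩
      CompositeCycle.sgn matching      ≡⟨ proj₂ (matching-data 0 (suc q)) ⟩
      alternating (suc q)              ∎
      where
      open ≡-Reasoning

      hamiltonian : SimpleCycle P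
      hamiltonian = record
        { length-1 = suc (q * 2) ; vertex = σ ; distinct = σ-injective
        ; label = edgeSign ; edge = λ u → proj₂ (edge u) }

      odd : alternating (suc (q * 2)) ≡ Sign.-
      odd = cong opposite (alternating-even q)

      ∏-edgeSign : ∏ edgeSign ≡ totalSign zero
      ∏-edgeSign = ∏≡product edgeSign (walkSign zero) 0 λ j → cong edgeSign (sym (next^-toℕ j))

      pair : ℕ → SimpleCycle P
      pair i = record
        { length-1 = 1
        ; vertex = λ { zero → walk t (i * 2) ; (suc zero) → walk t (suc (i * 2)) }
        ; distinct = λ { {zero} {zero} _ → refl
                       ; {zero} {suc zero} e → ⊥-elim (apart e)
                       ; {suc zero} {zero} e → ⊥-elim (apart (sym e))
                       ; {suc zero} {suc zero} _ → refl }
        ; label = λ _ → walkSign t (i * 2)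
        ; edge = λ { zero → walk-edge t (i * 2)
                   ; (suc zero) → trans (P-sym _ _) (walk-edge t (i * 2)) } }
        where
        apart : walk t (i * 2) ≢ walk t (suc (i * 2))
        apart = walk-distinct t ℕ.≤-refl (s≤s (s≤s (ℕ.m≤n+m (i * 2) (q * 2))))

      pair-disjoint : ∀ {i j} → i < j → j < suc q → VertexDisjoint (pair i) (pair j)
      pair-disjoint {i} {j} i<j j<q = λ
        { zero       zero       → apart (s≤s z≤n) (s≤s z≤n)
        ; zero       (suc zero) → apart {0} {1} (s≤s z≤n) (s≤s (s≤s z≤n))
        ; (suc zero) zero       → apart {1} {0} (s≤s (s≤s z≤n)) (s≤s z≤n)
        ; (suc zero) (suc zero) → apart {1} {1} (s≤s (s≤s z≤n)) (s≤s (s≤s z≤n)) }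
        where
        apart : ∀ {a b} → a < 2 → b < 2 → walk t (a + i * 2) ≢ walk t (b + j * 2)
        apart {a} {b} a<2 b<2 = walk-distinct t
          (ℕ.<-≤-trans (ℕ.+-monoˡ-< (i * 2) a<2) (ℕ.≤-trans (ℕ.*-monoˡ-≤ 2 i<j) (ℕ.m≤n+m (j * 2) b)))
          (ℕ.<-≤-trans (ℕ.+-monoˡ-< (j * 2) b<2) (ℕ.≤-trans (ℕ.*-monoˡ-≤ 2 j<q) (ℕ.m≤m+n n _)))

      pairs-disjoint : ∀ a k → a + k ≤ suc q → AllPairs VertexDisjoint (List.map pair (segment a k))
      pairs-disjoint a zero    _  = []
      pairs-disjoint a (suc k) a+k≤ =
        All.map⁺ (All-segment (suc a) k λ a<i i< → pair-disjoint a<i (ℕ.<-≤-trans i< bound))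
        ∷ pairs-disjoint (suc a) k bound
        where
        bound : suc a + k ≤ suc q
        bound = subst (_≤ suc q) (ℕ.+-suc a k) a+k≤

      matching : CompositeCycle P
      matching = record
        { factors = pair 0 List⁺.∷ List.map pair (segment 1 q)
        ; disjoint = pairs-disjoint 0 (suc q) ℕ.≤-refl }

      matching-data : ∀ a k → sum (List.map SimpleCycle.length (List.map pair (segment a k))) ≡ k * 2 ×
        foldr Sign._*_ Sign.+ (List.map SimpleCycle.sgn (List.map pair (segment a k))) ≡ alternating k
      matching-data a zero    = refl , refl
      matching-data a (suc k) = cong (2 +_) (proj₁ rest) , cong₂ Sign._*_ pair-sgn (proj₂ rest)
        where
        rest = matching-data (suc a) k
        pair-sgn : SimpleCycle.sgn (pair a) ≡ Sign.-
        pair-sgn = cong opposite (trans (cong (s Sign.*_) (Sign.*-identityʳ s)) (Sign.s*s≡+ s))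
          where s = walkSign t (a * 2)

-- Signs of the low coefficients of continuants and of the cycle determinant.

module ContinuantSigns where

  open import Algebra.Bundles using (CommutativeRing)
  import Algebra.Properties.Ring as RingProperties
  open import Data.Fin.Base using (zero; suc)
  open import Data.Integer.Base as ℤ using (+_)
  open import Data.Maybe.Base using (just)
  open import Data.Nat.Base as ℕ using (ℕ; zero; suc; _≤_)
  import Data.Nat.Properties as ℕ
  open import Data.Product.Base using (_×_; _,_; ∃-syntax; proj₁; proj₂)
  open import Data.Sign.Base as Sign using (Sign; opposite)
  import Data.Sign.Properties as Sign
  open import Level using (0ℓ)
  open import Relation.Binary.PropositionalEquality as ≡ using (_≡_; cong; subst)
  open import Defs
  open IntegerSolver
  open SparseDeterminants
  open Reals
  open Signs
  open Jets
  open CycleGraphs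

  -- The factors 0# and 1# are the components of the diagonal entry (0 , 1), the class of X.
  -- `linear-part` is the ε-component of the recursion, the `drop-` identities are its constant
  -- component.
  module ContinuantIdentities (S : CommutativeRing 0ℓ 0ℓ) where
    open CommutativeRing S hiding (zero)
    open IntegerCoefficients S
    open import Data.Integer.Base using (0ℤ)

    drop-zero : ∀ y z → 0# * y - z ≈ - z
    drop-zero = solve 2 (λ y z → con 0ℤ :* y :- z := :- z) refl

    drop-zeros : ∀ y a b → b ≈ 0# → 0# * y - a * b ≈ 0#
    drop-zeros y a b b≈0 = trans (+-congˡ (-‿cong (*-congˡ b≈0)))
      (solve 2 (λ y a → con 0ℤ :* y :- a :* con 0ℤ := con 0ℤ) refl y a)

    linear-part : ∀ y z a b c d → d ≈ 0# →
      0# * y + 1# * z - (a * b + c * d) ≈ z + - (a * b)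
    linear-part y z a b c d d≈0 = trans (+-cong (+-cong (zeroˡ y) (*-identityˡ z)) (-‿cong (+-congˡ (*-congˡ d≈0))))
      (solve 4 (λ z a b c → con 0ℤ :+ z :- (a :* b :+ c :* con 0ℤ) := z :+ :- (a :* b)) refl z a b c)

    drop-zero′ : ∀ y a b → 0# * y - a + b ≈ - a + b
    drop-zero′ = solve 3 (λ y a b → con 0ℤ :* y :- a :+ b := :- a :+ b) refl

    cancels : ∀ e → - (e + e) + (e + e) ≈ 0#
    cancels = solve 1 (λ e → :- (e :+ e) :+ (e :+ e) := con 0ℤ) refl

  open CommutativeRing ℝ-ring using (_+_; _*_; -_; _-_; 0#; 1#; -‿cong; *-cong; +-cong; refl; sym; trans; *-identityˡ)
  open RingProperties (CommutativeRing.ring ℝ-ring) using (-‿involutive; -1*x≈-x)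
  open ContinuantIdentities ℝ-ring
  open DualNumbers ℝ-ring

  -- Covers both having a given sign and, for a matrix with entries ±1, being
  -- equal to that sign.
  record IsSignPredicate (V : ℝ → Sign → Set) : Set where
    field
      V-cong : ∀ {x y} s → x ≃ y → V x s → V y s
      V-neg  : ∀ {x} s → V x s → V (- x) (opposite s)
      V-*    : ∀ {x y} s t → V x s → V y t → V (x * y) (s Sign.* t)
      V-1    : V 1# Sign.+

  HasSign-isSignPredicate : IsSignPredicate (λ x s → HasSign x (just s))
  HasSign-isSignPredicate = record
    { V-cong = λ {x} {y} → HasSign-cong {x} {y}
    ; V-neg = λ {x} → HasSign-neg {x}
    ; V-* = λ {x} {y} → HasSign-* {x} {y}
    ; V-1 = signValue-HasSign (just Sign.+) }

  ≃signValue-isSignPredicate : IsSignPredicate (λ x s → x ≃ signValue (just s))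
  ≃signValue-isSignPredicate = record
    { V-cong = λ {x} {y} s x≃y x≃s → trans {y} {x} {signValue (just s)} (sym {x} {y} x≃y) x≃s
    ; V-neg = λ {x} s x≃s → trans { - x} { - signValue (just s)} {signValue (just (opposite s))}
        (-‿cong {x} {signValue (just s)} x≃s) (neg-value s)
    ; V-* = λ {x} {y} s t x≃s y≃t → trans {x * y} {signValue (just s) * signValue (just t)} {signValue (just (s Sign.* t))}
        (*-cong {x} {signValue (just s)} {y} {signValue (just t)} x≃s y≃t) (*-value s t)
    ; V-1 = refl {1#} }
    where
    neg-value : ∀ s → - signValue (just s) ≃ signValue (just (opposite s))
    neg-value Sign.+ = refl { - 1#}
    neg-value Sign.- = -‿involutive 1#

    *-value : ∀ s t → signValue (just s) * signValue (just t) ≃ signValue (just (s Sign.* t))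
    *-value Sign.+ t = *-identityˡ (signValue (just t))
    *-value Sign.- t = trans { - 1# * signValue (just t)} { - signValue (just t)} {signValue (just (opposite t))}
      (-1*x≈-x (signValue (just t))) (neg-value t)

  open CommutativeRing dualRing using () renaming (_≈_ to _≈ᴰ_; _*_ to _*ᴰ_)

  module PathSigns
    (N : ℕ → ℕ → ℝ × ℝ) (N-sym : ∀ i j → N i j ≈ᴰ N j i) (N-diag : ∀ i → N i i ≈ᴰ (0# , 1#)) (s : ℕ → Sign)
    where

    open SparseDeterminant dualRing using (module SymmetricBanded; negate)
    open SymmetricBanded N N-sym (0# , 1#) N-diag public

    private
      w : ℕ → ℝ
      w i = proj₁ (N i (suc i))

      K : ℕ → ℕ → ℝ
      K a m = proj₁ (continuant a m)

      K′ : ℕ → ℕ → ℝ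
      K′ a m = proj₂ (continuant a m)

      restrict : ∀ {a b c} → b ≤ c → Tridiagonal a c → Tridiagonal a b
      restrict b≤c t a≤i i<j j<b = t a≤i i<j (ℕ.<-≤-trans j<b b≤c)

      shift : ∀ {a m b} → a ℕ.+ suc (suc m) ≤ b → suc (suc a) ℕ.+ m ≤ b
      shift {a} {m} {b} = subst (_≤ b) (≡.trans (ℕ.+-suc a (suc m)) (cong suc (ℕ.+-suc a m)))

    module _ {V : ℝ → Sign → Set} (isSignPredicate : IsSignPredicate V)
      (V-w : ∀ i → V (w i) (s i)) where
      open IsSignPredicate isSignPredicate

      V-square : ∀ {x y r t} → V x r → V y t → V (x * x * y) t
      V-square {x} {y} {r} {t} vx vy = subst (V (x * x * y)) (cong (Sign._* t) (Sign.s*s≡+ r))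
        (V-* {x * x} {y} (r Sign.* r) t (V-* {x} {x} r r vx vx) vy)

      -- Modulo X the recursion loses its middle term, so each pair of vertices contributes a factor
      -- -w². Altogether this is the unique perfect matching of the path.
      continuant-even : ∀ a k {b} → a ℕ.+ k ℕ.* 2 ≤ b → Tridiagonal a b → V (K a (k ℕ.* 2)) (alternating k)
      continuant-even a zero    _  _ = V-1
      continuant-even a (suc k) ≤b t = V-cong { - z} {K a (suc k ℕ.* 2)} (alternating (suc k))
        (sym {K a (suc k ℕ.* 2)} { - z} (trans {K a (suc k ℕ.* 2)} {0# * y - z} { - z}
          (proj₁ (continuant-step a (k ℕ.* 2) (restrict ≤b t))) (drop-zero y z)))
        (V-neg {z} (alternating k) (V-square {w a} {K (2 ℕ.+ a) (k ℕ.* 2)} {s a} {alternating k} (V-w a)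
          (continuant-even (2 ℕ.+ a) k (shift {a} ≤b) (tridiagonal-suc (tridiagonal-suc t)))))
        where
        y = K (suc a) (suc (k ℕ.* 2))
        z = w a * w a * K (2 ℕ.+ a) (k ℕ.* 2)

      V-superdiagonal : ∀ a m → V (proj₁ (superdiagonal a m)) (product s a m)
      V-superdiagonal a zero    = V-1
      V-superdiagonal a (suc m) = V-* {w a} {proj₁ (superdiagonal (suc a) m)} (s a) _ (V-w a) (V-superdiagonal (suc a) m)

      V-negate : ∀ k {y r} → V (proj₁ y) r → V (proj₁ (negate k y)) (alternating k Sign.* r)
      V-negate zero    v = v
      V-negate (suc k) {y} {r} v = subst (V (proj₁ (negate (suc k) y))) (≡.sym (Sign.*-assoc Sign.- (alternating k) r))
        (V-neg {proj₁ (negate k y)} (alternating k Sign.* r) (V-negate k {y} {r} v))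

      -- The three summands stay separate because necessity needs them to cancel and sufficiency
      -- needs them not to. `x` and `y` pair 0 with one of its neighbours and match the rest, and
      -- `u` is one orientation of the cycle; `c` is the sign of the closing entry.
      cycle-terms : ∀ k c → (let n = suc (suc k) ℕ.* 2; z = 3 ℕ.+ k ℕ.* 2) → V (proj₁ (N 0 z)) c →
        Tridiagonal 1 n → (∀ {j} → 2 ≤ j → j ℕ.< z → N 0 j ≈ᴰ (0# , 0#)) →
        ∃[ x ] ∃[ y ] ∃[ u ] proj₁ (continuant 0 n) ≃ - (x + y) + (u + u)
          × V x (alternating (suc k)) × V y (alternating (suc k))
          × V u (Sign.- Sign.* (s 0 Sign.* c Sign.* product s 1 (suc k ℕ.* 2)))
      cycle-terms k c vc t zeros = x , y , u
        , trans {proj₁ (continuant 0 (suc (suc k) ℕ.* 2))} {0# * proj₁ (proj₁ expansion) - (x + y) + (u + u)} { - (x + y) + (u + u)}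
            (proj₁ (proj₂ expansion)) (drop-zero′ (proj₁ (proj₁ expansion)) (x + y) (u + u))
        , V-square {w 0} {K 2 (suc k ℕ.* 2)} {s 0} (V-w 0) (continuant-even 2 (suc k) ℕ.≤-refl (tridiagonal-suc t))
        , V-square {proj₁ (N 0 z)} {K 1 (suc k ℕ.* 2)} {c} vc (continuant-even 1 (suc k) (ℕ.n≤1+n _) t)
        -- The number 2k + 1 of negations in `u` is odd, whence the factor `Sign.-`.
        , subst (V u) (cong (Sign._* r) (cong opposite (alternating-even k)))
            (V-negate (suc (k ℕ.* 2)) {N 0 1 *ᴰ N 0 z *ᴰ superdiagonal 1 (suc k ℕ.* 2)} {r}
              (V-* {w 0 * proj₁ (N 0 z)} {proj₁ (superdiagonal 1 (suc k ℕ.* 2))} _ _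
                (V-* {w 0} {proj₁ (N 0 z)} _ _ (V-w 0) vc) (V-superdiagonal 1 (suc k ℕ.* 2))))
        where
        z = 3 ℕ.+ k ℕ.* 2
        expansion = cycle-determinant (suc (k ℕ.* 2)) t zeros
        r = s 0 Sign.* c Sign.* product s 1 (suc k ℕ.* 2)
        x = w 0 * w 0 * K 2 (suc k ℕ.* 2)
        y = proj₁ (N 0 z) * proj₁ (N 0 z) * K 1 (suc k ℕ.* 2)
        u = proj₁ (negate (suc (k ℕ.* 2)) (N 0 1 *ᴰ N 0 z *ᴰ superdiagonal 1 (suc k ℕ.* 2)))

    module _ (w-sign : ∀ i → HasSign (w i) (just (s i))) where

      -- The linear coefficient obeys K′(m + 2) = K(m + 1) - w² K′(m) because the term with K(m)
      -- vanishes. Both summands have sign (-1)^(k + 1), so nothing cancels. A genuine sum arises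
      -- here, so this is stated for `HasSign` and not for an arbitrary sign predicate.
      continuant-odd : ∀ a k {b} → a ℕ.+ suc (k ℕ.* 2) ≤ b → Tridiagonal a b →
        K a (suc (k ℕ.* 2)) ≃ 0# × HasSign (K′ a (suc (k ℕ.* 2))) (just (alternating k))
      continuant-odd a zero    _  _ = proj₁ (continuant-1 a)
        , HasSign-cong {1#} {K′ a 1} Sign.+ (sym {K′ a 1} {1#} (proj₂ (continuant-1 a))) (signValue-HasSign (just Sign.+))
      continuant-odd a (suc k) {b} ≤b t =
          trans {K a m} {0# * y - w a * w a * z} {0#} (proj₁ step) (drop-zeros y (w a * w a) z (proj₁ rest))
        , HasSign-cong {y + - (w a * w a * z′)} {K′ a m} (alternating (suc k))
            (sym {K′ a m} {y + - (w a * w a * z′)} (trans {K′ a m}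
              {0# * y′ + 1# * y - (w a * w a * z′ + v * z)} {y + - (w a * w a * z′)}
              (proj₂ step) (linear-part y′ y (w a * w a) z′ v z (proj₁ rest))))
            (HasSign-+ {y} { - (w a * w a * z′)} (alternating (suc k))
              (continuant-even HasSign-isSignPredicate w-sign (suc a) (suc k)
                (subst (_≤ b) (ℕ.+-suc a (suc k ℕ.* 2)) ≤b) (tridiagonal-suc t))
              (HasSign-neg {w a * w a * z′} (alternating k)
                (V-square HasSign-isSignPredicate w-sign {w a} {z′} {s a} {alternating k} (w-sign a) (proj₂ rest))))
        where
        m = suc (suc k ℕ.* 2)
        step = continuant-step a (suc (k ℕ.* 2)) (restrict ≤b t)
        rest = continuant-odd (2 ℕ.+ a) k (shift {a} ≤b) (tridiagonal-suc (tridiagonal-suc t))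
        y = K (suc a) (suc k ℕ.* 2)
        y′ = K′ (suc a) (suc k ℕ.* 2)
        z = K (2 ℕ.+ a) (suc (k ℕ.* 2))
        z′ = K′ (2 ℕ.+ a) (suc (k ℕ.* 2))
        v = proj₂ (N a (suc a) *ᴰ N a (suc a))

-- Characteristic polynomials of a cycle matrix and its principal submatrices.

module CharacteristicPolynomials where

  open import Algebra.Bundles using (CommutativeRing; RawRing)
  import Algebra.Definitions.RawSemiring as RawSemiringOps
  import Algebra.Properties.AbelianGroup as AbelianGroupProperties
  import Algebra.Properties.Ring as RingProperties
  open import Data.Bool.Base using (Bool; true; false; if_then_else_)
  open import Data.Empty using (⊥-elim)
  open import Data.Fin.Base using (Fin; zero; suc; punchIn)
  import Data.Fin.Properties as Fin
  open import Data.Integer.Base as ℤ using (+_)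
  import Data.Integer.Properties as ℤ
  open import Data.List.Base as List using (List; []; _∷_; tabulate)
  import Data.List.Relation.Binary.Permutation.Propositional as Perm
  open import Data.List.Relation.Binary.Permutation.Propositional.Properties using (drop-∷)
  open import Data.Maybe.Base using (just; nothing)
  open import Data.Nat.Base as ℕ using (ℕ; zero; suc; s≤s)
  import Data.Nat.Properties as ℕ
  open import Data.Product.Base using (_×_; _,_; ∃-syntax; proj₁; proj₂)
  open import Data.Sign.Base as Sign using (Sign; opposite)
  import Data.Sign.Properties as Sign
  open import Function.Base using (id)
  open import Function.Bundles using (mk⇔)
  open import Relation.Binary.PropositionalEquality as ≡ using (_≡_; cong; subst)
  open import Relation.Nullary.Decidable using (does; dec-true; dec-false; does-⇔)
  open import Defs
  open Determinants
  open SparseDeterminants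
  open Reals
  open Signs
  open Jets
  open CycleGraphs
  open ContinuantSigns

  open CommutativeRing ℝ-ring using (_+_; _*_; -_; _-_; 0#; 1#; -‿cong; +-cong; refl; sym; trans; *-identityʳ; +-identityˡ; -‿inverseʳ)
  open RingProperties (CommutativeRing.ring ℝ-ring) using (-0#≈0#)
  open DualNumbers ℝ-ring
  open Polynomial ℝ-rawRing using (coeff; add)
  open CommutativeRing dualRing using () renaming (_≈_ to _≈ᴰ_; refl to reflᴰ; sym to symᴰ; trans to transᴰ)
  open Determinant dualRing
  open RawRing ℝ[X] using () renaming (_≈_ to _≈ᴾ_; _*_ to _*ᴾ_)
  open RawSemiringOps (RawRing.rawSemiring ℝ[X]) using () renaming (_^_ to _^ᴾ_)

  -- The outcome of the diagonal test is an argument, so that equivalent tests, after a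
  -- transposition or a `punchIn`, can be exchanged by substitution.
  characteristicEntry : Bool → ℝ → Poly
  characteristicEntry b a = add (if b then X else []) (List.map -_ (const a))

  entry-cong : ∀ b {x y} → x ≃ y → jet (characteristicEntry b x) ≈ᴰ jet (characteristicEntry b y)
  entry-cong true  {x} {y} x≃y = +-cong {0#} {0#} { - x} { - y} (refl {0#}) (-‿cong {x} {y} x≃y) , refl {1#}
  entry-cong false {x} {y} x≃y = -‿cong {x} {y} x≃y , refl {0#}

  entry-constant : ∀ b x → proj₁ (jet (characteristicEntry b x)) ≃ - x
  entry-constant true  x = +-identityˡ (- x)
  entry-constant false x = refl { - x}

  module Spectrum {m} (P : SignPattern (suc m)) (P-sym : Symmetric P) (P-diag : ∀ i → P i i ≡ nothing)
    (iso : IsCycleGraph (UnderlyingGraph P)) (A : Matrix ℝ (suc m)) (A-sym : ∀ u v → A u v ≃ A v u)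
    (A-zero : ∀ u v → P u v ≡ nothing → A u v ≃ 0ℝ) (t : Fin (suc m)) where

    open CyclePattern P P-sym P-diag iso

    private
      n = suc m

      E : Fin n → Fin n → ℝ × ℝ
      E u v = jet (characteristicEntry (does (u Fin.≟ v)) (A u v))

      N : ℕ → ℕ → ℝ × ℝ
      N i j = E (walk t i) (walk t j)

      N-sym : ∀ i j → N i j ≈ᴰ N j i
      N-sym i j = subst (λ b → jet (characteristicEntry b (A u v)) ≈ᴰ E v u)
        (does-⇔ (mk⇔ ≡.sym ≡.sym) (v Fin.≟ u) (u Fin.≟ v))
        (entry-cong (does (v Fin.≟ u)) {A u v} {A v u} (A-sym u v))
        where
        u = walk t i
        v = walk t j

      N-diag : ∀ i → N i i ≈ᴰ (0# , 1#)
      N-diag i = subst (λ b → jet (characteristicEntry b (A u u)) ≈ᴰ (0# , 1#))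
        (≡.sym (dec-true (u Fin.≟ u) ≡.refl))
        (transᴰ {jet (characteristicEntry true (A u u))} {jet (characteristicEntry true 0ℝ)} {0# , 1#}
          (entry-cong true {A u u} {0ℝ} (A-zero u u (P-diag u))) (-‿inverseʳ 0# , refl {1#}))
        where u = walk t i

      N-zero : ∀ {i j} → suc i ℕ.< j → suc j ℕ.< n ℕ.+ i → N i j ≈ᴰ (0# , 0#)
      N-zero {i} {j} i+1<j j+1< = subst (λ b → jet (characteristicEntry b (A u v)) ≈ᴰ (0# , 0#))
        (≡.sym (dec-false (u Fin.≟ v) (walk-distinct t (ℕ.≤-trans (ℕ.n≤1+n _) i+1<j) (ℕ.≤-trans (ℕ.n≤1+n _) j+1<))))
        (transᴰ {jet (characteristicEntry false (A u v))} {jet (characteristicEntry false 0ℝ)} {0# , 0#}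
          (entry-cong false {A u v} {0ℝ} (A-zero u v (nonadjacent t i+1<j j+1<))) (-0#≈0# , refl {0#}))
        where
        u = walk t i
        v = walk t j

      -- Off the diagonal, X I - A has the negated entries of A.
      weightSign : ℕ → Sign
      weightSign i = opposite (walkSign t i)

      open PathSigns N N-sym N-diag weightSign

      -- Starting at 1 leaves out the pair 0 and n - 1, which the closing edge joins.
      tridiagonal : Tridiagonal 1 n
      tridiagonal {i} {j} 1≤i i+1<j j<n = N-zero i+1<j
        (ℕ.≤-trans (s≤s j<n) (subst (ℕ._≤ n ℕ.+ i) (ℕ.+-comm n 1) (ℕ.+-monoʳ-≤ n 1≤i)))

    jet-charPoly : jet (charPoly A) ≈ᴰ continuant 0 n
    jet-charPoly = transᴰ {jet (charPoly A)} {minor E (tabulate id) (tabulate id)} {continuant 0 n}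
      (homo-det ℝ[X] jet jet-homomorphism (λ i j → characteristicEntry (does (i Fin.≟ j)) (A i j)) E id id λ i j → reflᴰ {E i j})
      (transᴰ {minor E (tabulate id) (tabulate id)} {minor E (List.map (walk t) (segment 0 n)) (List.map (walk t) (segment 0 n))} {continuant 0 n}
        (symᴰ {minor E (List.map (walk t) (segment 0 n)) (List.map (walk t) (segment 0 n))} {minor E (tabulate id) (tabulate id)} (minor-↭ E (walk-↭ t)))
        (minor-map E (walk t) (walk t) (segment 0 n) (segment 0 n)))

    jet-charPoly-principal : jet (charPoly (principal A (walk t 0))) ≈ᴰ continuant 1 m
    jet-charPoly-principal = transᴰ {jet (charPoly (principal A j))} {minor E rest rest} {continuant 1 m}
      (homo-det ℝ[X] jet jet-homomorphism (λ i k → characteristicEntry (does (i Fin.≟ k)) (principal A j i k)) E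
        (punchIn j) (punchIn j) λ i k →
        subst (λ b → jet (characteristicEntry b (A (punchIn j i) (punchIn j k))) ≈ᴰ E (punchIn j i) (punchIn j k))
          (does-⇔ (mk⇔ (Fin.punchIn-injective j i k) (cong (punchIn j))) (punchIn j i Fin.≟ punchIn j k) (i Fin.≟ k))
          (reflᴰ {E (punchIn j i) (punchIn j k)}))
      (transᴰ {minor E rest rest} {minor E path path} {continuant 1 m}
        -- Up to permutation both enumerations of all vertices have the deleted vertex `j` at their
        -- head, and it is cancelled from both.
        (symᴰ {minor E path path} {minor E rest rest} (minor-↭ E (drop-∷
          (Perm.trans (Perm.↭-sym (tabulate-punchIn id j)) (walk-↭ t)))))
        (minor-map E (walk t) (walk t) (segment 1 m) (segment 1 m)))
      where
      j = walk t 0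
      rest = tabulate (punchIn j)
      path = List.map (walk t) (segment 1 m)

    module _ {V : ℝ → Sign → Set} (isSignPredicate : IsSignPredicate V)
      (V-A : ∀ u v s → P u v ≡ just s → V (A u v) s) where
      open IsSignPredicate isSignPredicate

      V-entry : ∀ i j {s} → P (walk t i) (walk t j) ≡ just s → V (proj₁ (N i j)) (opposite s)
      V-entry i j {s} eq = V-cong { - A u v} {proj₁ (N i j)} (opposite s)
        (sym {proj₁ (N i j)} { - A u v} (entry-constant (does (u Fin.≟ v)) (A u v))) (V-neg {A u v} s (V-A u v s eq))
        where
        u = walk t i
        v = walk t j

      V-weight : ∀ i → V (proj₁ (N i (suc i))) (weightSign i)
      V-weight i = V-entry i (suc i) (walk-edge t i)

      charPoly-principal-even : ∀ k → m ≡ k ℕ.* 2 → V (coeff (charPoly (principal A (walk t 0))) 0) (alternating k)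
      charPoly-principal-even k m≡ = V-cong {proj₁ (continuant 1 m)} {coeff p 0} (alternating k)
        (sym {coeff p 0} {proj₁ (continuant 1 m)} (proj₁ jet-charPoly-principal))
        (subst (λ l → V (proj₁ (continuant 1 l)) (alternating k)) (≡.sym m≡)
          (continuant-even isSignPredicate V-weight 1 k (ℕ.≤-reflexive (cong suc (≡.sym m≡))) tridiagonal))
        where p = charPoly (principal A (walk t 0))

      -- The term `u` is minus a product of n weights -a. As n is even, the n inner minus signs
      -- cancel and the labels of the pattern remain.
      charPoly-even : ∀ k → n ≡ suc (suc k) ℕ.* 2 → ∃[ x ] ∃[ y ] ∃[ u ] coeff (charPoly A) 0 ≃ - (x + y) + (u + u)
        × V x (alternating (suc k)) × V y (alternating (suc k)) × V u (opposite (totalSign t))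
      charPoly-even k ≡.refl =
        let x , y , u , eq , vx , vy , vu = cycle-terms isSignPredicate V-weight k (opposite (ℓ (suc l)))
              -- The closing edge leaves position n - 1, so its entry reaches row 0 by symmetry.
              (V-cong {proj₁ (N (suc l) 0)} {proj₁ (N 0 (suc l))} _ (proj₁ (N-sym (suc l) 0)) (V-entry (suc l) 0 closing))
              tridiagonal (λ 2≤j j<z → N-zero 2≤j (ℕ.<-≤-trans (s≤s j<z) (ℕ.m≤m+n n 0)))
        in x , y , u
          , trans {coeff (charPoly A) 0} {proj₁ (continuant 0 n)} { - (x + y) + (u + u)} (proj₁ jet-charPoly) eq
          , vx , vy , subst (V u) (cong opposite signs) vu
        where
        open ≡.≡-Reasoning
        l = suc k ℕ.* 2
        ℓ = walkSign t

        closing : P (walk t (suc l)) (walk t 0) ≡ just (ℓ (suc l))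
        closing = ≡.trans (cong (P (walk t (suc l))) (≡.sym (walk-closed t))) (walk-edge t (suc l))

        product-opposite : ∀ a m → product weightSign a m ≡ alternating m Sign.* product ℓ a m
        product-opposite a zero    = ≡.refl
        product-opposite a (suc m) = ≡.trans (cong (weightSign a Sign.*_) (product-opposite (suc a) m))
          (regroup (ℓ a) (alternating m) _)
          where
          regroup : ∀ a b c → opposite a Sign.* (b Sign.* c) ≡ opposite b Sign.* (a Sign.* c)
          regroup Sign.+ Sign.+ c = ≡.refl
          regroup Sign.+ Sign.- c = Sign.opposite-involutive c
          regroup Sign.- Sign.+ c = ≡.sym (Sign.opposite-involutive c)
          regroup Sign.- Sign.- c = ≡.refl

        swap-last : ∀ a b c → opposite a Sign.* opposite b Sign.* c ≡ a Sign.* (c Sign.* b)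
        swap-last Sign.+ Sign.+ c      = ≡.sym (Sign.*-identityʳ c)
        swap-last Sign.+ Sign.- Sign.+ = ≡.refl
        swap-last Sign.+ Sign.- Sign.- = ≡.refl
        swap-last Sign.- Sign.+ Sign.+ = ≡.refl
        swap-last Sign.- Sign.+ Sign.- = ≡.refl
        swap-last Sign.- Sign.- Sign.+ = ≡.refl
        swap-last Sign.- Sign.- Sign.- = ≡.refl

        signs : weightSign 0 Sign.* weightSign (suc l) Sign.* product weightSign 1 l ≡ totalSign t
        signs = begin
          weightSign 0 Sign.* weightSign (suc l) Sign.* product weightSign 1 l
            ≡⟨ cong (weightSign 0 Sign.* weightSign (suc l) Sign.*_) (≡.trans (product-opposite 1 l)
                 (cong (Sign._* product ℓ 1 l) (alternating-even (suc k)))) ⟩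
          weightSign 0 Sign.* weightSign (suc l) Sign.* product ℓ 1 l  ≡⟨ swap-last (ℓ 0) (ℓ (suc l)) (product ℓ 1 l) ⟩
          ℓ 0 Sign.* (product ℓ 1 l Sign.* ℓ (suc l))                  ≡⟨ cong (ℓ 0 Sign.*_) (product-∷ʳ ℓ 1 l) ⟨
          ℓ 0 Sign.* product ℓ 1 (suc l)                               ∎

    charPoly-principal-odd : (∀ u v s → P u v ≡ just s → HasSign (A u v) (just s)) →
      ∀ k → m ≡ suc (k ℕ.* 2) →
      (let p = charPoly (principal A (walk t 0))) → coeff p 0 ≃ 0# × HasSign (coeff p 1) (just (alternating k))
    charPoly-principal-odd A-sign k ≡.refl =
        trans {coeff p 0} {proj₁ (continuant 1 m)} {0#} (proj₁ jet-charPoly-principal) (proj₁ odd)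
      , HasSign-cong {proj₂ (continuant 1 m)} {coeff p 1} (alternating k)
          (sym {coeff p 1} {proj₂ (continuant 1 m)} (proj₂ jet-charPoly-principal)) (proj₂ odd)
      where
      p = charPoly (principal A (walk t 0))
      odd = continuant-odd (V-weight HasSign-isSignPredicate A-sign) 1 k ℕ.≤-refl tridiagonal

  multiplicity-zero : ∀ p s → HasSign (coeff p 0) (just s) → IsRootMultiplicity p 0ℝ 0
  multiplicity-zero p s sgn = p , factor-0 p , HasSign⇒#0 s
    (HasSign-cong {coeff p 0} {eval p 0ℝ} s (sym {eval p 0ℝ} {coeff p 0} (eval-0 p)) sgn)

  -- Dropping the constant coefficient divides by X, and the quotient takes the linear coefficient
  -- as its value at 0.
  multiplicity-one : ∀ p s → coeff p 0 ≃ 0# → HasSign (coeff p 1) (just s) → IsRootMultiplicity p 0ℝ 1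
  multiplicity-one p s p₀≃0 sgn = q , factor-1 p p₀≃0 , HasSign⇒#0 s
    (HasSign-cong {coeff p 1} {eval q 0ℝ} s (sym {eval q 0ℝ} {coeff p 1}
      (trans {eval q 0ℝ} {coeff q 0} {coeff p 1} (eval-0 q) (coeff-drop p))) sgn)
    where
    q = List.drop 1 p
    coeff-drop : ∀ p → coeff (List.drop 1 p) 0 ≃ coeff p 1
    coeff-drop []      = refl {0#}
    coeff-drop (_ ∷ p) = refl {coeff p 0}

  difference-one : ∀ m m′ → ℤ.+ m′ ℤ.- ℤ.+ m ≡ ℤ.+ 1 → m′ ≡ suc m
  difference-one m m′ eq = ℤ.+-injective (≡.trans (≡.sym (//-rightDividesˡ (ℤ.+ m) (ℤ.+ m′))) (cong (ℤ._+ ℤ.+ m) eq))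
    where open AbelianGroupProperties ℤ.+-0-abelianGroup using (//-rightDividesˡ)

  -- Whatever m is, m′ = m + 1 is positive, so X divides the characteristic polynomial of A(j).
  constant-root : ∀ {n} {A : Matrix ℝ (suc n)} {j} → IsPVertex A j → coeff (charPoly (principal A j)) 0 ≃ 0#
  constant-root {A = A} {j} (m , m′ , _ , (q , eq , _) , diff) = go m′ q eq (difference-one m m′ diff)
    where
    p = charPoly (principal A j)
    go : ∀ m′ q → p ≈ᴾ (X-0 ^ᴾ m′) *ᴾ q → m′ ≡ suc m → coeff p 0 ≃ 0#
    go _ q eq ≡.refl = multiplicity-suc-coeff m p q eq

  -- A singular A excludes m = 0, since the cofactor would be apart from 0 at 0. Hence m′ is at
  -- least 2 and X² divides the characteristic polynomial of A(j).
  linear-root : ∀ {n} {A : Matrix ℝ (suc n)} {j} → IsPVertex A j → coeff (charPoly A) 0 ≃ 0# →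
    coeff (charPoly (principal A j)) 1 ≃ 0#
  linear-root {A = A} (zero , m′ , (q , eq , q#0) , _ , _) p₀≃0 = ⊥-elim (#0⇒≄0 {eval q 0ℝ} q#0
    (trans {eval q 0ℝ} {coeff q 0} {0#} (eval-0 q) (trans {coeff q 0} {coeff (charPoly A) 0} {0#}
      (sym {coeff (charPoly A) 0} {coeff q 0} (multiplicity-0-coeff (charPoly A) q eq)) p₀≃0)))
  linear-root {A = A} {j} (suc m , m′ , _ , (q , eq , _) , diff) _ = go m′ q eq (difference-one (suc m) m′ diff)
    where
    p = charPoly (principal A j)
    go : ∀ m′ q → p ≈ᴾ (X-0 ^ᴾ m′) *ᴾ q → m′ ≡ suc (suc m) → coeff p 1 ≃ 0#
    go _ q eq ≡.refl = multiplicity-2+-coeff m p q eq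

-- The equivalence.

open import Defs
open import Algebra.Bundles using (CommutativeRing)
open import Data.Empty using (⊥-elim)
open import Data.Fin.Base using (Fin; zero)
open import Data.Maybe.Base using (nothing; just)
open import Data.Nat.Base as ℕ using (ℕ; zero; suc; _≤_; s≤s)
open import Data.Nat.Divisibility using (_∣_; divides)
import Data.Nat.Properties as ℕ
open import Data.Product.Base using (_×_; _,_; ∃-syntax; proj₁; proj₂)
open import Data.Sign.Base as Sign using (opposite)
import Data.Sign.Properties as Sign
open import Data.Sum.Base using (_⊎_; inj₁; inj₂)
open import Function.Bundles using (_⇔_; mk⇔)
open import Relation.Binary.PropositionalEquality as ≡ using (_≡_; _≢_; cong; subst)
open import Relation.Nullary.Decidable.Core using (yes; no)
open Reals using (ℝ-ring)
open Signs
open CycleGraphs using (alternating; module CyclePattern)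
open ContinuantSigns using (HasSign-isSignPredicate; ≃signValue-isSignPredicate; module ContinuantIdentities)
open CharacteristicPolynomials
open CommutativeRing ℝ-ring using (_+_; -_; 0#; -‿cong; +-cong; refl; sym; trans)
open ContinuantIdentities ℝ-ring using (cancels)
open Polynomial ℝ-rawRing using (coeff)

half : ∀ n → (∃[ q ] n ≡ q ℕ.* 2) ⊎ (∃[ q ] n ≡ suc (q ℕ.* 2))
half zero    = inj₁ (0 , ≡.refl)
half (suc n) with half n
... | inj₁ (q , eq) = inj₂ (q , cong suc eq)
... | inj₂ (q , eq) = inj₁ (suc q , cong suc eq)

signMatrix : ∀ {n} → SignPattern n → Matrix ℝ n
signMatrix P u v = signValue (P u v)

signMatrix∈Q-SYM : ∀ {n} (P : SignPattern n) → Symmetric P → signMatrix P ∈Q-SYM P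
signMatrix∈Q-SYM P P-sym = record
  { symmetric = λ u v → subst (λ s → signValue (P u v) ≃ signValue s) (P-sym u v) (refl {signValue (P u v)})
  ; signs = λ u v → signValue-HasSign (P u v) }

theorem3p1 : (n : ℕ) → 3 ≤ n → (P : SignPattern n) → Symmetric P →
    (∀ i → P i i ≡ nothing) → IsCycleGraph (UnderlyingGraph P) →
    RequiresFullPVertices P ⇔ (2 ∣ n × SameSignCompositeCycles P n)
theorem3p1 (suc m) 3≤n P P-sym P-diag iso = mk⇔ necessary sufficient
  where
  n = suc m
  open CyclePattern P P-sym P-diag iso
  open _∈Q-SYM_

  entry-sign : ∀ {A} → A ∈Q-SYM P → ∀ {s} u v → P u v ≡ s → HasSign (A u v) s
  entry-sign {A} A∈Q u v eq = subst (HasSign (A u v)) eq (signs A∈Q u v)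

  A₀ = signMatrix P
  A₀∈Q = signMatrix∈Q-SYM P P-sym

  module S {A} (A∈Q : A ∈Q-SYM P) t =
    Spectrum P P-sym P-diag iso A (symmetric A∈Q) (λ u v eq → entry-sign A∈Q u v eq) t

  odd-impossible : RequiresFullPVertices P → ∀ q → n ≢ suc (q ℕ.* 2)
  odd-impossible full q n≡ = #0⇒≄0 {c} (HasSign⇒#0 (alternating q)
      (S.charPoly-principal-even A₀∈Q zero HasSign-isSignPredicate
        (λ u v s eq → entry-sign A₀∈Q u v eq) q (ℕ.suc-injective n≡)))
    (constant-root {A = A₀} (full A₀ A₀∈Q (walk zero 0)))
    where c = coeff (charPoly (principal A₀ (walk zero 0))) 0

  -- At the test matrix x, y and u all equal the same e = ±1, and -(e + e) + (e + e) makes it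
  -- singular. Then 0 would have to be at least a double root for A(j), against its nonzero linear
  -- coefficient.
  bad-sign-impossible : RequiresFullPVertices P → ∀ k → n ≡ suc (suc k) ℕ.* 2 →
    opposite (totalSign zero) ≢ alternating (suc k)
  bad-sign-impossible full k n≡ bad = #0⇒≄0 {c₁} (HasSign⇒#0 (alternating (suc k))
      (proj₂ (S.charPoly-principal-odd A₀∈Q zero (λ u v s eq → entry-sign A₀∈Q u v eq) (suc k) (ℕ.suc-injective n≡))))
    (linear-root {A = A₀} (full A₀ A₀∈Q (walk zero 0)) singular)
    where
    c₁ = coeff (charPoly (principal A₀ (walk zero 0))) 1

    singular : coeff (charPoly A₀) 0 ≃ 0#
    singular =
      let x , y , u , eq , vx , vy , vu = S.charPoly-even A₀∈Q zero ≃signValue-isSignPredicate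
            (λ u v s eq → subst (λ r → A₀ u v ≃ signValue r) eq (refl {A₀ u v})) k n≡
          e = signValue (just (alternating (suc k)))
          vu′ = subst (λ s → u ≃ signValue (just s)) bad vu
      in trans {coeff (charPoly A₀) 0} { - (x + y) + (u + u)} {0#} eq
        (trans { - (x + y) + (u + u)} { - (e + e) + (e + e)} {0#}
          (+-cong { - (x + y)} { - (e + e)} {u + u} {e + e}
            (-‿cong {x + y} {e + e} (+-cong {x} {e} {y} {e} vx vy)) (+-cong {u} {e} {u} {e} vu′ vu′))
          (cancels e))

  -- The bound n ≥ 3 is used here: an even n is at least 4, the form in which `charPoly-even` takes
  -- it.
  n-half : ∀ q → n ≡ q ℕ.* 2 → ∃[ k ] q ≡ suc (suc k)
  n-half (suc (suc k)) _ = k , ≡.refl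
  n-half (suc zero) n≡ with s≤s (s≤s ()) ← subst (3 ≤_) n≡ 3≤n

  necessary : RequiresFullPVertices P → 2 ∣ n × SameSignCompositeCycles P n
  necessary full with half n
  ... | inj₂ (q , n≡) = ⊥-elim (odd-impossible full q n≡)
  ... | inj₁ (q , n≡) with n-half q n≡
  ...   | k , ≡.refl = divides q n≡ , λ Γ Δ ∣Γ∣ ∣Δ∣ → ≡.trans (sgn Γ ∣Γ∣) (≡.sym (sgn Δ ∣Δ∣))
    where
    -- There are only two signs, so excluding (-1)^(q - 1) leaves (-1)^q.
    good : opposite (totalSign zero) ≡ alternating q
    good with opposite (totalSign zero) Sign.≟ alternating (suc k)
    ... | yes bad = ⊥-elim (bad-sign-impossible full k n≡ bad)
    ... | no ¬bad = ≢⇒opposite ¬bad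
      where
      ≢⇒opposite : ∀ {s r} → s ≢ r → s ≡ opposite r
      ≢⇒opposite {Sign.+} {Sign.+} ne = ⊥-elim (ne ≡.refl)
      ≢⇒opposite {Sign.+} {Sign.-} _  = ≡.refl
      ≢⇒opposite {Sign.-} {Sign.+} _  = ≡.refl
      ≢⇒opposite {Sign.-} {Sign.-} ne = ⊥-elim (ne ≡.refl)

    sgn = composite-sgn q n≡ zero good

  sufficient : 2 ∣ n × SameSignCompositeCycles P n → RequiresFullPVertices P
  sufficient (divides q n≡ , same) A A∈Q j = go q n≡ (n-half q n≡) (walk-start j)
    where
    A-sign : ∀ u v s → P u v ≡ just s → HasSign (A u v) (just s)
    A-sign u v s eq = entry-sign A∈Q u v eq

    nonsingular : ∀ k → n ≡ suc (suc k) ℕ.* 2 → Fin n →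
      HasSign (coeff (charPoly A) 0) (just (alternating (suc (suc k))))
    nonsingular k n≡ t =
      let x , y , u , eq , vx , vy , vu = S.charPoly-even A∈Q t HasSign-isSignPredicate A-sign k n≡
          ε = alternating (suc (suc k))
          -- The hypothesis on composite cycles gives `u` the sign (-1)^q, which -(x + y) has in any
          -- case, so the sum cannot vanish.
          vu′ = subst (λ s → HasSign u (just s)) (sameSign⇒ (suc k) n≡ same t) vu
      in HasSign-cong { - (x + y) + (u + u)} {coeff (charPoly A) 0} ε
        (sym {coeff (charPoly A) 0} { - (x + y) + (u + u)} eq)
        (HasSign-+ { - (x + y)} {u + u} ε
          (HasSign-neg {x + y} (alternating (suc k)) (HasSign-+ {x} {y} (alternating (suc k)) vx vy))
          (HasSign-+ {u} {u} ε vu′ vu′))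

    go : ∀ q → n ≡ q ℕ.* 2 → ∃[ k ] q ≡ suc (suc k) → ∃[ t ] walk t 0 ≡ j → IsPVertex A j
    -- Each vertex is treated by starting the walk at it, so that only the deletion of position 0
    -- ever has to be computed.
    go _ n≡ (k , ≡.refl) (t , ≡.refl) = 0 , 1
      , multiplicity-zero (charPoly A) (alternating (suc (suc k))) (nonsingular k n≡ t)
      , multiplicity-one (charPoly (principal A (walk t 0))) (alternating (suc k)) (proj₁ path) (proj₂ path)
      , ≡.refl
      where path = S.charPoly-principal-odd A∈Q t A-sign (suc k) (ℕ.suc-injective n≡)
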